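{- Let $\mathcal C$ be a monotone class of coloured digraphs of a fixed finite signature. The following are equivalent: (1) $\underline{\mathcal C}$ is nowhere dense; (2) $\underline{\mathcal C}$ is superflat; (3) $\mathcal C$ is stable; (4) $\underline{\mathcal C}$ is stable; (5) $\mathcal C$ is dependent; (6) $\underline{\mathcal C}$ is dependent.
   Context: A coloured digraph is a relational structure all of whose relation symbols have arity at most $2$. A class $\mathcal C$ of relational structures is monotone if whenever $M\to N$ is an injective homomorphism and $N\in\mathcal C$, then $M\in\mathcal C$. The underlying (Gaifman) graph $\underline M$ of $M$ has the elements of $M$ as vertices, and $a\ne b$ adjacent iff they occur together in some tuple of some relation of $M$; $\underline{\mathcal C}=\{\underline M:M\in\mathcal C\}$. Graphs are undirected, loopless, without multiple edges, not necessarily finite. A graph $H$ is an $r$-minor of $G$ if there is a (not necessarily induced) subgraph $U\subseteq G$ and an equivalence relation $\epsilon$ on the vertices of $U$ whose classes induce connected subgraphs of $U$, each class containing a vertex from which the other vertices of the class have distance at most $r$, with $H\cong U/\epsilon$ (contract each class to a vertex). A class of graphs is nowhere dense if for every $r$ there is a finite bound on the $m$ such that the complete graph $K_m$ is an $r$-minor of a member. $K_m^r$ is $K_m$ with each edge subdivided exactly $r$ times; a class is superflat if for every $r$ there is an $m$ such that $K_m^r$ is not isomorphic to a subgraph of any member. For a class $\mathcal C$ of structures: a first-order formula $\phi(\bar x,\bar y)$ has the order property w.r.t. $\mathcal C$ if for every $n$ there are $M\in\mathcal C$ and tuples $\bar a_0,\dots,\bar a_{n-1},\bar b_0,\dots,\bar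 b_{n-1}$ in $M$ with $M\models\phi(\bar a_i,\bar b_j)$ iff $i<j$; $\mathcal C$ is stable if no formula has the order property. $\phi(\bar x,\bar y)$ has the independence property w.r.t. $\mathcal C$ if for every $n$ there are $M\in\mathcal C$, tuples $\bar a_0,\dots,\bar a_{n-1}$ and $\bar b_J$ ($J\subseteq\{0,\dots,n-1\}$) in $M$ with $M\models\phi(\bar a_i,\bar b_J)$ iff $i\in J$; $\mathcal C$ is dependent if no formula has the independence property. -}

module Defs where

open import Level using (Level; Setω) renaming (suc to lsuc; zero to lzero)
open import Data.Nat using (ℕ; zero; suc; _≤_; _+_)
open import Data.Fin using (Fin; toℕ) renaming (zero to fz; suc to fs; _<_ to _<ᶠ_)
open import Data.Fin.Subset using (Subset) renaming (_∈_ to _∈ˢ_)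
open import Data.Vec using (Vec; []; _∷_; map)
open import Data.Vec.Membership.Propositional using (_∈_)
import Data.Vec.Functional as VF
open import Data.Product using (Σ; _×_; _,_; ∃; Σ-syntax; ∃-syntax)
open import Data.Sum using (_⊎_; inj₁; inj₂)
open import Data.Empty using (⊥)
open import Relation.Nullary using (¬_)
open import Relation.Binary.PropositionalEquality using (_≡_; _≢_)
open import Function.Bundles using (_⇔_)
open import Function.Definitions using (Injective)

-- Signatures: finitely many relation symbols, each of arity ≤ 2
-- (coloured digraphs).

record Signature : Set where
  field
    nsym  : ℕ
    arity : Fin nsym → ℕ
    arity≤2 : ∀ R → arity R ≤ 2
open Signature public

record Structure (σ : Signature) : Set₁ where
  field
    Car : Set
    rel : (R : Fin (nsym σ)) → Vec Car (arity σ R) → Set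
open Structure public

IsHom : ∀ {σ} (M N : Structure σ) → (Car M → Car N) → Set
IsHom {σ} M N f = ∀ (R : Fin (nsym σ)) (t : Vec (Car M) (arity σ R)) →
  rel M R t → rel N R (map f t)

InjHom : ∀ {σ} (M N : Structure σ) → Set
InjHom M N = Σ[ f ∈ (Car M → Car N) ] (Injective _≡_ _≡_ f × IsHom M N f)

Iso : ∀ {σ} (M N : Structure σ) → Set
Iso {σ} M N = Σ[ f ∈ (Car M → Car N) ]
  (Injective _≡_ _≡_ f × (∀ y → ∃[ x ] f x ≡ y) ×
   (∀ (R : Fin (nsym σ)) (t : Vec (Car M) (arity σ R)) → rel M R t ⇔ rel N R (map f t)))

-- Classes of structures (closure under isomorphism is implied by monotonicity).
Class : Signature → Set₂
Class σ = Structure σ → Set₁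

Monotone : ∀ {σ} → Class σ → Set₁
Monotone {σ} C = ∀ (M N : Structure σ) → InjHom M N → C N → C M

graphSig : Signature
graphSig = record { nsym = 1 ; arity = λ _ → 2 ; arity≤2 = λ _ → Data.Nat.s≤s (Data.Nat.s≤s Data.Nat.z≤n) }

Edge : (G : Structure graphSig) → Car G → Car G → Set
Edge G a b = rel G fz (a ∷ b ∷ [])

IsGraph : Structure graphSig → Set
IsGraph G = (∀ a b → Edge G a b → Edge G b a) × (∀ a → ¬ Edge G a a)

GaifEdge : ∀ {σ} (M : Structure σ) → Car M → Car M → Set
GaifEdge {σ} M a b = a ≢ b × Σ[ R ∈ Fin (nsym σ) ] Σ[ t ∈ Vec (Car M) (arity σ R) ]
  (rel M R t × a ∈ t × b ∈ t)

Gaifman : ∀ {σ} → Structure σ → Structure graphSig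
Gaifman M = record { Car = Car M ; rel = λ { _ (a ∷ b ∷ []) → GaifEdge M a b } }

Underlying : ∀ {σ} → Class σ → Class graphSig
Underlying {σ} C G = Σ[ M ∈ Structure σ ] (C M × Iso G (Gaifman M))

K : ℕ → Structure graphSig
K m = record { Car = Fin m ; rel = λ { _ (i ∷ j ∷ []) → i ≢ j } }

-- Vertices of K_m^r: the m branch vertices, and for each pair i < j the
-- r subdivision vertices (i,j,k), k < r, on the path i — (i,j,0) — … — (i,j,r-1) — j.
SubdVert : ℕ → ℕ → Set
SubdVert m r = Fin m ⊎ (Σ[ i ∈ Fin m ] Σ[ j ∈ Fin m ] (i <ᶠ j × Fin r))

SubdFwd : (m r : ℕ) → SubdVert m r → SubdVert m r → Set
SubdFwd m r (inj₁ i) (inj₁ j) = r ≡ 0 × i <ᶠ j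
SubdFwd m r (inj₁ i) (inj₂ (i' , j' , _ , k)) = i ≡ i' × toℕ k ≡ 0
SubdFwd m r (inj₂ (i , j , _ , k)) (inj₁ j') = j ≡ j' × suc (toℕ k) ≡ r
SubdFwd m r (inj₂ (i , j , _ , k)) (inj₂ (i' , j' , _ , k')) =
  i ≡ i' × j ≡ j' × toℕ k' ≡ suc (toℕ k)

Ksub : ℕ → ℕ → Structure graphSig
Ksub m r = record { Car = SubdVert m r
                  ; rel = λ { _ (a ∷ b ∷ []) → SubdFwd m r a b ⊎ SubdFwd m r b a } }

WalkIn : (G : Structure graphSig) → (Car G → Set) → ℕ → Car G → Car G → Set
WalkIn G P zero a b = a ≡ b
WalkIn G P (suc r) a b = a ≡ b ⊎ Σ[ c ∈ Car G ] (Edge G a c × P c × WalkIn G P r c b)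

-- H is an r-minor of G: a subgraph U of G (a graph with an injective
-- homomorphism into G) and a surjection π : U → H whose fibres (the classes
-- of ε) each contain a centre from which every vertex of the class is reached
-- by a path of length ≤ r inside the class, such that H is the contraction U/ε
-- (distinct classes adjacent iff some edge of U joins them).
IsMinor : ℕ → Structure graphSig → Structure graphSig → Set₁
IsMinor r H G =
  Σ[ U ∈ Structure graphSig ] (IsGraph U × InjHom U G ×
  Σ[ π ∈ (Car U → Car H) ]
    ((∀ x → ∃[ u ] π u ≡ x) ×
     (∀ x → Σ[ c ∈ Car U ] (π c ≡ x ×
              (∀ v → π v ≡ x → WalkIn U (λ w → π w ≡ x) r c v))) ×
     (∀ x y → Edge H x y ⇔ (x ≢ y × Σ[ u ∈ Car U ] Σ[ v ∈ Car U ]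
                                       (π u ≡ x × π v ≡ y × Edge U u v)))))

NowhereDense : Class graphSig → Set₁
NowhereDense 𝒢 = ∀ (r : ℕ) → ∃[ N ] (∀ (m : ℕ) (G : Structure graphSig) →
  𝒢 G → IsMinor r (K m) G → m ≤ N)

Superflat : Class graphSig → Set₁
Superflat 𝒢 = ∀ (r : ℕ) → ∃[ m ] (∀ (G : Structure graphSig) →
  𝒢 G → ¬ InjHom (Ksub m r) G)

data Formula (σ : Signature) : ℕ → Set where
  atom : ∀ {k} (R : Fin (nsym σ)) → Vec (Fin k) (arity σ R) → Formula σ k
  _≐_  : ∀ {k} → Fin k → Fin k → Formula σ k
  ~_   : ∀ {k} → Formula σ k → Formula σ k
  _∧'_ : ∀ {k} → Formula σ k → Formula σ k → Formula σ k
  _∨'_ : ∀ {k} → Formula σ k → Formula σ k → Formula σ k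
  ∃'   : ∀ {k} → Formula σ (suc k) → Formula σ k
  ∀'   : ∀ {k} → Formula σ (suc k) → Formula σ k

Sat : ∀ {σ k} (M : Structure σ) → Formula σ k → (Fin k → Car M) → Set
Sat M (atom R xs) ρ = rel M R (map ρ xs)
Sat M (x ≐ y) ρ = ρ x ≡ ρ y
Sat M (~ φ) ρ = ¬ Sat M φ ρ
Sat M (φ ∧' ψ) ρ = Sat M φ ρ × Sat M ψ ρ
Sat M (φ ∨' ψ) ρ = Sat M φ ρ ⊎ Sat M ψ ρ
Sat M (∃' φ) ρ = Σ[ a ∈ Car M ] Sat M φ (a VF.∷ ρ)
Sat M (∀' φ) ρ = ∀ (a : Car M) → Sat M φ (a VF.∷ ρ)

OrderProperty : ∀ {σ} → Class σ → (p q : ℕ) → Formula σ (p + q) → Set₁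
OrderProperty {σ} C p q φ = ∀ (n : ℕ) → Σ[ M ∈ Structure σ ] (C M ×
  Σ[ a ∈ (Fin n → Fin p → Car M) ] Σ[ b ∈ (Fin n → Fin q → Car M) ]
    (∀ i j → Sat M φ (a i VF.++ b j) ⇔ (i <ᶠ j)))

Stable : ∀ {σ} → Class σ → Set₁
Stable C = ∀ p q φ → ¬ OrderProperty C p q φ

IndependenceProperty : ∀ {σ} → Class σ → (p q : ℕ) → Formula σ (p + q) → Set₁
IndependenceProperty {σ} C p q φ = ∀ (n : ℕ) → Σ[ M ∈ Structure σ ] (C M ×
  Σ[ a ∈ (Fin n → Fin p → Car M) ] Σ[ b ∈ (Subset n → Fin q → Car M) ]
    (∀ i J → Sat M φ (a i VF.++ b J) ⇔ (i ∈ˢ J)))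

Dependent : ∀ {σ} → Class σ → Set₁
Dependent C = ∀ p q φ → ¬ IndependenceProperty C p q φ

{-# OPTIONS --safe #-}

-- The proof runs: superflat ⇒ uniformly quasi-wide ⇒ nowhere dense ⇒ superflat, quasi-wide ⇒ stable
-- ⇒ dependent ⇒ superflat.
--
-- Quasi-wideness.  Suppose points pairwise at distance ≥ r are joined by paths of length r.  By Ramsey's
-- theorem either all these paths share a vertex, which is then their midpoint and is deleted, or the pattern
-- of coincidences between the vertices of the paths is uniform, and then some segment of the paths forms a
-- subdivided biclique, hence an exactly subdivided clique.  The deleted midpoints together with their paths
-- to the points form a configuration of the same kind, so their number is bounded in terms of r.
--
-- Stability.  In a long ladder of tuples, quasi-wideness gives two tuples that are far apart once a bounded
-- set S is deleted, and that have the same type over S.  Then they can be interchanged: in the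
-- Ehrenfeucht-Fraïssé game, moves near one tuple are answered near the other one and all remaining moves by
-- themselves.  So the formula cannot tell i < j from j < i.
--
-- Independence.  If all cliques occur r-subdivided then, by monotonicity, so do all bipartite graphs, and
-- these are coded by the formula "there is a walk of length r + 1".
module Submission where

open import Defs
open import Level using (Level; 0ℓ)
open import Axiom.ExcludedMiddle using (ExcludedMiddle)
open import Data.Empty using (⊥; ⊥-elim)
open import Data.Fin using (Fin; toℕ; fromℕ<; combine; remQuot; splitAt; _↑ˡ_; _↑ʳ_) renaming (zero to fz; suc to fs; _<_ to _<ᶠ_)
open import Data.Fin.Properties using (toℕ<n; toℕ-fromℕ<; toℕ-injective; toℕ-↑ˡ; toℕ-↑ʳ; ↑ˡ-injective; ↑ʳ-injective; combine-injective; remQuot-combine; pigeonhole) renaming (<⇒≢ to <ᶠ⇒≢; <-asym to <ᶠ-asym; <-cmp to <ᶠ-cmp; _<?_ to _<ᶠ?_)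
open import Data.Fin.Subset using (Subset; inside; outside) renaming (_∈_ to _∈ˢ_)
open import Data.List using (List; []; _∷_; length; _++_; map; lookup; allFin; cartesianProductWith; concatMap)
open import Data.List.Membership.Propositional using (_∈_; _∉_)
open import Data.List.Membership.Propositional.Properties using (∈-++⁺ˡ; ∈-++⁺ʳ; ∈-++⁻; ∈-map⁺; ∈-map⁻; ∈-concatMap⁺; ∈-cartesianProductWith⁺; ∈-allFin; ∈-lookup)
open import Data.List.Properties using (length-++; length-tabulate)
open import Data.List.Relation.Binary.Sublist.Propositional using (_⊆_; []; _∷_; _∷ʳ_; ⊆-refl; ⊆-trans; minimum)
open import Data.List.Relation.Unary.All using (All; []; _∷_)
open import Data.List.Relation.Unary.AllPairs using (AllPairs; []; _∷_)
open import Data.List.Relation.Unary.AllPairs.Properties using (tabulate⁺-<)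
import Data.List.Relation.Unary.Any as Any
open import Data.List.Relation.Unary.Any using (Any; here; there; index)
open import Data.List.Relation.Unary.Any.Properties using (lookup-index)
open import Data.Nat
open import Data.Nat.Properties
open import Data.Product using (Σ; Σ-syntax; ∃; ∃-syntax; _×_; _,_; proj₁; proj₂; swap; uncurry)
open import Data.Sum using (_⊎_; inj₁; inj₂) renaming (map to ⊎-map)
open import Data.Unit using (⊤; tt)
open import Data.Vec using (Vec; []; _∷_; tabulate) renaming (map to mapᵛ)
import Data.Vec.Functional as VF
open import Data.Vec.Functional.Properties using (lookup-++ˡ; lookup-++ʳ)
open import Data.Vec.Membership.Propositional using () renaming (_∈_ to _∈ᵛ_)
open import Data.Vec.Membership.Propositional.Properties using () renaming (∈-map⁺ to ∈ᵛ-map⁺)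
open import Data.Vec.Properties using (map-∘; lookup⇒[]=; []=⇒lookup; lookup∘tabulate)
import Data.Vec.Relation.Unary.Any as VAny
open import Function using (_∘_; id)
open import Function.Bundles using (_⇔_; mk⇔; Equivalence)
open import Function.Definitions using (Injective)
open import Relation.Binary.Definitions using (tri<; tri≈; tri>)
open import Relation.Binary.PropositionalEquality
open import Relation.Nullary using (¬_; yes; no; does)
open import Relation.Nullary.Decidable using (dec-true)

-- Ramsey's theorem for subsequences of lists

-- All bounds are computed from the function `f` that superflatness provides, never from a
-- structure, because the conditions to be reached concern a whole class. Superflatness forbids only
-- cliques whose edges are all subdivided equally often, so paths of varying length are of no use.
-- For this reason distances are raised by one at a time: points at distance at least r that are not
-- yet further apart are joined by paths of length exactly r, and these are geodesic, hence free of
-- repetitions. Segments cut out between two fixed positions again have a common length, and so do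
-- pairs of segments meeting in a right vertex of a biclique. In the stability proof it is the
-- asymmetry of the ladder that is attacked: two tuples change places while everything far away
-- stays put. As relations are at most binary, an atom sees only a pair of pebbles, and a pair
-- separated by the gap, outside S, lies in no common tuple.

Pred : Set → ℕ → Set₁
Pred X zero    = Set
Pred X (suc k) = X → Pred X k

neg : ∀ {X} k → Pred X k → Pred X k
neg zero    P = ¬ P
neg (suc k) P = λ x → neg k (P x)

-- Tuples are read in list order, so colourings need no symmetry and the relative order of indices
-- may enter the colour.
AllSub : ∀ {X} k → Pred X k → List X → Set
AllSub zero    P xs       = P
AllSub (suc k) P []       = ⊤
AllSub (suc k) P (x ∷ xs) = AllSub k (P x) xs × AllSub (suc k) P xs

AllSub-⊆ : ∀ {X} k {P : Pred X k} {xs ys} → ys ⊆ xs → AllSub k P xs → AllSub k P ys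
AllSub-⊆ zero    τ          h       = h
AllSub-⊆ (suc k) []         h       = tt
AllSub-⊆ (suc k) (y ∷ʳ τ)   (_ , h) = AllSub-⊆ (suc k) τ h
AllSub-⊆ (suc k) (refl ∷ τ) (g , h) = AllSub-⊆ k τ g , AllSub-⊆ (suc k) τ h

-- Indices in ℕ keep the arithmetic free of `Fin`; nothing is claimed about indices beyond the list,
-- where the default appears.
nth : ∀ {X : Set} → X → List X → ℕ → X
nth d []       i       = d
nth d (x ∷ xs) zero    = x
nth d (x ∷ xs) (suc i) = nth d xs i

module _ {X : Set} (d : X) where
  nth₁ : ∀ {P : Pred X 1} xs {i} → AllSub 1 P xs → i < length xs → P (nth d xs i)
  nth₁ (x ∷ xs) {zero}  (p , _) _       = p
  nth₁ (x ∷ xs) {suc i} (_ , h) (s≤s l) = nth₁ xs h l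

  nth₂ : ∀ {P : Pred X 2} xs {i j} → AllSub 2 P xs → i < j → j < length xs →
         P (nth d xs i) (nth d xs j)
  nth₂ (x ∷ xs) {zero}  {suc j} (p , _) _       (s≤s l) = nth₁ xs p l
  nth₂ (x ∷ xs) {suc i} {suc j} (_ , h) (s≤s a) (s≤s l) = nth₂ xs h a l

  nth₃ : ∀ {P : Pred X 3} xs {i j k} → AllSub 3 P xs → i < j → j < k → k < length xs →
         P (nth d xs i) (nth d xs j) (nth d xs k)
  nth₃ (x ∷ xs) {zero}  {suc j} {suc k} (p , _) _       (s≤s b) (s≤s l) = nth₂ xs p b l
  nth₃ (x ∷ xs) {suc i} {suc j} {suc k} (_ , h) (s≤s a) (s≤s b) (s≤s l) = nth₃ xs h a b l

  nth₄ : ∀ {P : Pred X 4} xs {i j k m} → AllSub 4 P xs → i < j → j < k → k < m → m < length xs →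
         P (nth d xs i) (nth d xs j) (nth d xs k) (nth d xs m)
  nth₄ (x ∷ xs) {zero}  {suc j} {suc k} {suc m} (p , _) _       (s≤s b) (s≤s c) (s≤s l) = nth₃ xs p b c l
  nth₄ (x ∷ xs) {suc i} {suc j} {suc k} {suc m} (_ , h) (s≤s a) (s≤s b) (s≤s c) (s≤s l) = nth₄ xs h a b c l

Homog : ∀ {X} k → Pred X k → List X → Set
Homog k P xs = AllSub k P xs ⊎ AllSub k (neg k P) xs

Homog-⊆ : ∀ {X} k {P : Pred X k} {xs ys} → ys ⊆ xs → Homog k P xs → Homog k P ys
Homog-⊆ k τ = ⊎-map (AllSub-⊆ k τ) (AllSub-⊆ k τ)

-- The intermediate stage of the Erdős-Rado argument: the colour of a tuple depends on its first
-- entry only.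
EndHomog : ∀ {X} k → Pred X (suc k) → List X → Set
EndHomog k P []       = ⊤
EndHomog k P (x ∷ xs) = Homog k (P x) xs × EndHomog k P xs

splitEndHomog : ∀ {X} k {P : Pred X (suc k)} xs → EndHomog k P xs →
  ∃[ ys ] ∃[ zs ] (ys ⊆ xs × zs ⊆ xs × AllSub (suc k) P ys × AllSub (suc k) (neg (suc k) P) zs ×
                   length xs ≡ length ys + length zs)
splitEndHomog k []       h = [] , [] , [] , [] , tt , tt , refl
splitEndHomog k (x ∷ xs) (h , hs) with splitEndHomog k xs hs
splitEndHomog k (x ∷ xs) (inj₁ h , hs) | ys , zs , σ , τ , p , n , e =
  x ∷ ys , zs , refl ∷ σ , x ∷ʳ τ , (AllSub-⊆ k σ h , p) , n , cong suc e
splitEndHomog k (x ∷ xs) (inj₂ h , hs) | ys , zs , σ , τ , p , n , e =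
  ys , x ∷ zs , x ∷ʳ σ , refl ∷ τ , p , (AllSub-⊆ k τ h , n) ,
  trans (cong suc e) (sym (+-suc (length ys) (length zs)))


module Ramsey (em : ExcludedMiddle 0ℓ) where

  RamseyBound : ℕ → ℕ → ℕ → Set₁
  RamseyBound k m N = ∀ {X : Set} (P : Pred X k) xs → N ≤ length xs →
    ∃[ ys ] (ys ⊆ xs × m ≤ length ys × Homog k P ys)

  endHomogeneous : ∀ k → (∀ m → ∃ (RamseyBound k m)) → ∀ m → ∃[ N ]
    (∀ {X : Set} (P : Pred X (suc k)) xs → N ≤ length xs →
      ∃[ ys ] (ys ⊆ xs × m ≤ length ys × EndHomog k P ys))
  endHomogeneous k R zero = 0 , λ P xs _ → [] , minimum xs , z≤n , tt
  endHomogeneous k R (suc m) with endHomogeneous k R m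
  ... | N , rec with R N
  ... | N' , ram = suc N' , go
    where
    go : ∀ {X : Set} (P : Pred X (suc k)) xs → suc N' ≤ length xs →
      ∃[ ys ] (ys ⊆ xs × suc m ≤ length ys × EndHomog k P ys)
    go P (x ∷ xs) (s≤s le) with ram (P x) xs le
    ... | ys , τ , l , h with rec P ys l
    ... | zs , σ , l' , e = x ∷ zs , refl ∷ ⊆-trans σ τ , s≤s l' , Homog-⊆ k σ h , e

  abstract
    ramsey : ∀ k m → ∃ (RamseyBound k m)
    ramsey zero m = m , λ P xs le → xs , ⊆-refl , le , decide P
      where
      decide : ∀ (P : Set) → P ⊎ ¬ P
      decide P with em {P = P}
      ... | yes p = inj₁ p
      ... | no ¬p = inj₂ ¬p
    -- Among 2m first entries, one of the two colours is attached to at least m.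
    ramsey (suc k) m with endHomogeneous k (ramsey k) (m + m)
    ... | N , eh = N , go
      where
      go : RamseyBound (suc k) m N
      go P xs le with eh P xs le
      ... | ys , τ , l , h with splitEndHomog k ys h
      ... | as , bs , α , β , p , n , e with m ≤? length as
      ... | yes m≤a = as , ⊆-trans α τ , m≤a , inj₁ p
      ... | no m≰a with m ≤? length bs
      ... | yes m≤b = bs , ⊆-trans β τ , m≤b , inj₂ n
      ... | no m≰b = ⊥-elim (<-irrefl refl (≤-<-trans (subst (m + m ≤_) e l) (+-mono-< (≰⇒> m≰a) (≰⇒> m≰b))))

  abstract
    ramseyFamily : ∀ k c m → ∃[ N ] (∀ {X : Set} (P : Fin c → Pred X k) xs → N ≤ length xs →
      ∃[ ys ] (ys ⊆ xs × m ≤ length ys × (∀ e → Homog k (P e) ys)))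
    ramseyFamily k zero m = m , λ P xs le → xs , ⊆-refl , le , λ ()
    ramseyFamily k (suc c) m with ramsey k m
    ... | N₁ , ram with ramseyFamily k c N₁
    ... | N₂ , fam = N₂ , go
      where
      go : ∀ {X : Set} (P : Fin (suc c) → Pred X k) xs → N₂ ≤ length xs →
        ∃[ ys ] (ys ⊆ xs × m ≤ length ys × (∀ e → Homog k (P e) ys))
      go P xs le with fam (P ∘ fs) xs le
      ... | ys , τ , l , h with ram (P fz) ys l
      ... | zs , σ , l' , h' = zs , ⊆-trans σ τ , l' ,
        λ { fz → h' ; (fs e) → Homog-⊆ k σ (h e) }

-- Subdivided cliques from path systems

SubdEmbedding : ℕ → ℕ → {V : Set} → (V → V → Set) → Set
SubdEmbedding m r {V} E = Σ[ h ∈ (SubdVert m r → V) ]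
  (Injective _≡_ _≡_ h × (∀ x y → SubdFwd m r x y → E (h x) (h y)))

-- Left vertices are numbered below t, and right vertices from t on, one for each ordered pair of
-- left ones. Left numbers stay below right ones because the paths P i j used later are meaningful
-- only for i < j. `pt-inj` allows just the coincidences at shared ends.
record SubdividedBiclique {V : Set} (E : V → V → Set) (t d : ℕ) : Set where
  field
    pt : ℕ → ℕ → ℕ → V
  Right : ℕ → Set
  Right b = t ≤ b × b < t + t * t
  field
    pt-start : ∀ {i b b'} → i < t → Right b → Right b' → pt i b 0 ≡ pt i b' 0
    pt-end   : ∀ {i i' b} → i < t → i' < t → Right b → pt i b d ≡ pt i' b d
    pt-edge  : ∀ {i b q} → i < t → Right b → q < d → E (pt i b q) (pt i b (suc q))
    pt-inj   : ∀ {i b q i' b' q'} → i < t → Right b → q ≤ d → i' < t → Right b' → q' ≤ d →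
               pt i b q ≡ pt i' b' q' → q ≡ q' × (q < d → i ≡ i') × (0 < q → b ≡ b')

-- Each pair i < j of left vertices is joined through a right vertex of its own.
subdividedClique : ∀ {V : Set} {E : V → V → Set} → (∀ {x y} → E x y → E y x) →
  ∀ {t d'} → SubdividedBiclique E t (suc d') → ∀ m → m ≤ t → SubdEmbedding m (d' + suc d') E
subdividedClique {V} {E} E-sym {t} {d'} H m m≤t = h , h-inj , h-edge
  where
  open SubdividedBiclique H
  d r : ℕ
  d = suc d'
  r = d' + d

  mid : Fin m → Fin m → ℕ
  mid i j = t + toℕ (combine i j)

  mid-right : ∀ i j → Right (mid i j)
  mid-right i j = m≤m+n t _ , +-monoʳ-< t (<-≤-trans (toℕ<n (combine i j)) (*-mono-≤ m≤t m≤t))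

  mid-inj : ∀ i j i' j' → mid i j ≡ mid i' j' → i ≡ i' × j ≡ j'
  mid-inj i j i' j' e = combine-injective i j i' j' (toℕ-injective (+-cancelˡ-≡ t _ _ e))

  lt : (i : Fin m) → toℕ i < t
  lt i = <-≤-trans (toℕ<n i) m≤t

  -- Out from i to the right vertex and back to j: 2d edges, hence 2d - 1 = d' + d inner vertices.
  route : Fin m → Fin m → ℕ → V
  route i j n with n ≤? d
  ... | yes _ = pt (toℕ i) (mid i j) n
  ... | no _  = pt (toℕ j) (mid i j) (d + d ∸ n)

  d+d∸n<d : ∀ {n} → ¬ n ≤ d → d + d ∸ n < d
  d+d∸n<d {n} n≰d = m<n+o⇒m∸n<o (d + d) n (+-monoˡ-< d (≰⇒> n≰d))

  route-edge : ∀ i j n → n < d + d → E (route i j n) (route i j (suc n))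
  route-edge i j n n< with n ≤? d | suc n ≤? d
  ... | yes _   | yes sn≤d = pt-edge (lt i) (mid-right i j) sn≤d
  ... | yes n≤d | no sn≰d  = subst₂ E (trans (pt-end (lt j) (lt i) (mid-right i j)) (cong (pt (toℕ i) (mid i j)) (sym n≡d))) (cong (pt (toℕ j) (mid i j)) e)
                               (E-sym (pt-edge (lt j) (mid-right i j) ≤-refl))
    where
    n≡d : n ≡ d
    n≡d = ≤-antisym n≤d (s≤s⁻¹ (≰⇒> sn≰d))
    e : d' ≡ d + d ∸ suc n
    e = trans (sym (m+n∸n≡m d' d)) (cong (d + d ∸_) (cong suc (sym n≡d)))
  ... | no n≰d  | yes sn≤d = ⊥-elim (n≰d (≤-trans (n≤1+n n) sn≤d))
  ... | no n≰d  | no _     = subst (λ q → E (pt (toℕ j) (mid i j) q) (pt (toℕ j) (mid i j) (d + d ∸ suc n))) e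
                               (E-sym (pt-edge (lt j) (mid-right i j) (subst (_≤ d) (sym e) (<⇒≤ (d+d∸n<d n≰d)))))
    where
    e : suc (d + d ∸ suc n) ≡ d + d ∸ n
    e = sym (+-∸-assoc 1 n<)

  route-end : ∀ i j → route i j (d + d) ≡ pt (toℕ j) (mid i j) 0
  route-end i j with d + d ≤? d
  ... | yes p = ⊥-elim (m+1+n≰m d p)
  ... | no _  = cong (pt (toℕ j) (mid i j)) (n∸n≡0 (d + d))

  h : SubdVert m r → V
  -- Any right vertex gives the same point by `pt-start`; that of the diagonal pair is always at
  -- hand.
  h (inj₁ i)               = pt (toℕ i) (mid i i) 0
  h (inj₂ (i , j , _ , k)) = route i j (suc (toℕ k))

  start : ∀ i j → h (inj₁ i) ≡ pt (toℕ i) (mid i j) 0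
  start i j = pt-start (lt i) (mid-right i i) (mid-right i j)

  start' : ∀ i j → h (inj₁ j) ≡ pt (toℕ j) (mid i j) 0
  start' i j = pt-start (lt j) (mid-right j j) (mid-right i j)

  0<d+d∸ : ∀ (k : Fin r) → 0 < d + d ∸ suc (toℕ k)
  0<d+d∸ k = m<n⇒0<n∸m (s≤s (toℕ<n k))

  branch≢inner : ∀ i i' j' (k : Fin r) → h (inj₁ i) ≢ route i' j' (suc (toℕ k))
  branch≢inner i i' j' k e with suc (toℕ k) ≤? d
  ... | yes k≤ = 0≢1+n (proj₁ (pt-inj (lt i) (mid-right i i) z≤n (lt i') (mid-right i' j') k≤ e))
  ... | no k≰ = <⇒≢ (0<d+d∸ k) (proj₁ (pt-inj (lt i) (mid-right i i) z≤n (lt j') (mid-right i' j') (<⇒≤ (d+d∸n<d k≰)) e))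

  inner-inj : ∀ i j (p : toℕ i < toℕ j) k i' j' (p' : toℕ i' < toℕ j') k' →
    route i j (suc (toℕ k)) ≡ route i' j' (suc (toℕ k')) → i ≡ i' × j ≡ j' × k ≡ k'
  inner-inj i j p k i' j' p' k' e with suc (toℕ k) ≤? d | suc (toℕ k') ≤? d
  ... | yes k≤ | yes k≤' =
    let q≡ , _ , b≡ = pt-inj (lt i) (mid-right i j) k≤ (lt i') (mid-right i' j') k≤' e
        i≡ , j≡ = mid-inj i j i' j' (b≡ (s≤s z≤n))
    in i≡ , j≡ , toℕ-injective (suc-injective q≡)
  -- An outgoing half meets a returning half. The common right vertex forces j = j', the position
  -- below d forces i = j', and i < j fails.
  ... | yes k≤ | no k≰' =
    let q≡ , i≡j , b≡ = pt-inj (lt i) (mid-right i j) k≤ (lt j') (mid-right i' j') (<⇒≤ (d+d∸n<d k≰')) e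
        _ , j≡ = mid-inj i j i' j' (b≡ (s≤s z≤n))
    in ⊥-elim (<⇒≢ p (trans (i≡j (subst (_< d) (sym q≡) (d+d∸n<d k≰'))) (cong toℕ (sym j≡))))
  ... | no k≰ | yes k≤' =
    let q≡ , j≡i , b≡ = pt-inj (lt j) (mid-right i j) (<⇒≤ (d+d∸n<d k≰)) (lt i') (mid-right i' j') k≤' e
        i≡ , _ = mid-inj i j i' j' (b≡ (0<d+d∸ k))
    in ⊥-elim (<⇒≢ p (trans (cong toℕ i≡) (sym (j≡i (d+d∸n<d k≰)))))
  ... | no k≰ | no k≰' =
    let q≡ , _ , b≡ = pt-inj (lt j) (mid-right i j) (<⇒≤ (d+d∸n<d k≰)) (lt j') (mid-right i' j') (<⇒≤ (d+d∸n<d k≰')) e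
        i≡ , j≡ = mid-inj i j i' j' (b≡ (0<d+d∸ k))
    in i≡ , j≡ , toℕ-injective (suc-injective (∸-cancelˡ-≡ (m≤n⇒m≤1+n (toℕ<n k)) (m≤n⇒m≤1+n (toℕ<n k')) q≡))

  h-inj : Injective _≡_ _≡_ h
  h-inj {inj₁ i} {inj₁ i'} e =
    cong inj₁ (toℕ-injective (proj₁ (proj₂ (pt-inj (lt i) (mid-right i i) z≤n (lt i') (mid-right i' i') z≤n e)) (s≤s z≤n)))
  h-inj {inj₁ i} {inj₂ (i' , j' , _ , k)} e = ⊥-elim (branch≢inner i i' j' k e)
  h-inj {inj₂ (i' , j' , _ , k)} {inj₁ i} e = ⊥-elim (branch≢inner i i' j' k (sym e))
  h-inj {inj₂ (i , j , p , k)} {inj₂ (i' , j' , p' , k')} e with inner-inj i j p k i' j' p' k' e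
  ... | refl , refl , refl = cong (λ p → inj₂ (i , j , p , k)) (<-irrelevant p p')

  h-edge : ∀ x y → SubdFwd m r x y → E (h x) (h y)
  h-edge (inj₁ i) (inj₁ j) (r≡0 , _) = ⊥-elim (m+1+n≢0 d' r≡0)
  h-edge (inj₁ i) (inj₂ (.i , j , _ , k)) (refl , k≡0) =
    subst₂ E (sym (start i j)) (cong (route i j ∘ suc) (sym k≡0)) (route-edge i j 0 (s≤s z≤n))
  h-edge (inj₂ (i , j , _ , k)) (inj₁ .j) (refl , k≡) =
    subst (E (route i j (suc (toℕ k)))) (trans (cong (route i j ∘ suc) k≡) (trans (route-end i j) (sym (start' i j))))
      (route-edge i j (suc (toℕ k)) (s≤s (toℕ<n k)))
  h-edge (inj₂ (i , j , _ , k)) (inj₂ (.i , .j , _ , k')) (refl , refl , k≡) =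
    subst (E (route i j (suc (toℕ k)))) (cong (route i j ∘ suc) (sym k≡)) (route-edge i j (suc (toℕ k)) (s≤s (toℕ<n k)))

-- Path systems and the patterns of their coincidences

range : ℕ → ℕ → List ℕ
range a zero    = []
range a (suc n) = a ∷ range (suc a) n

length-range : ∀ a n → length (range a n) ≡ n
length-range a zero    = refl
length-range a (suc n) = cong suc (length-range (suc a) n)

range-bounds : ∀ a n → AllSub 1 (λ x → a ≤ x × x < a + n) (range a n)
range-bounds a zero    = tt
range-bounds a (suc n) = (≤-refl , m<m+n a (s≤s z≤n)) , widen (range (suc a) n) (range-bounds (suc a) n)
  where
  widen : ∀ xs → AllSub 1 (λ x → suc a ≤ x × x < suc a + n) xs → AllSub 1 (λ x → a ≤ x × x < a + suc n) xs
  widen []       _             = tt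
  widen (x ∷ xs) ((p , q) , h) = (<⇒≤ p , subst (x <_) (sym (+-suc a n)) q) , widen xs h

range-increasing : ∀ a n → AllSub 2 _<_ (range a n)
range-increasing a zero    = tt
range-increasing a (suc n) = lower (range (suc a) n) (range-bounds (suc a) n) , range-increasing (suc a) n
  where
  lower : ∀ xs → AllSub 1 (λ x → suc a ≤ x × x < suc a + n) xs → AllSub 1 (a <_) xs
  lower []       _             = tt
  lower (x ∷ xs) ((p , _) , h) = p , lower xs h

-- P i j is a path of length ℓ from a vertex depending only on i to one depending only on j; the field moves
-- excludes a vertex common to all the paths.
record PathSystem {V : Set} (E : V → V → Set) (n ℓ : ℕ) (P : ℕ → ℕ → ℕ → V) : Set where
  field
    start : ∀ {i j j'} → i < j → j < j' → j' < n → P i j 0 ≡ P i j' 0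
    end   : ∀ {i i' j} → i < i' → i' < j → j < n → P i j ℓ ≡ P i' j ℓ
    edge  : ∀ {i j k} → i < j → j < n → k < ℓ → E (P i j k) (P i j (suc k))
    inj   : ∀ {i j k k'} → i < j → j < n → k ≤ ℓ → k' ≤ ℓ → P i j k ≡ P i j k' → k ≡ k'
    moves : ∀ {i j i' j' k} → i < j → j < i' → i' < j' → j' < n → k ≤ ℓ → P i j k ≢ P i' j' k

restrict : ∀ {V : Set} {E : V → V → Set} {n ℓ P L} (y : ℕ → ℕ) →
  (∀ {i j} → i < j → j < L → y i < y j) → (∀ {i} → i < L → y i < n) →
  PathSystem E n ℓ P → PathSystem E L ℓ (λ i j → P (y i) (y j))
restrict y mono bound S = record
  { start = λ a b c → start (mono a (<-trans b c)) (mono b c) (bound c)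
  ; end   = λ a b c → end (mono a (<-trans b c)) (mono b c) (bound c)
  ; edge  = λ a b → edge (mono a b) (bound b)
  ; inj   = λ a b → inj (mono a b) (bound b)
  ; moves = λ a b c e → moves (mono a (<-trans b (<-trans c e))) (mono b (<-trans c e)) (mono c e) (bound e)
  }
  where open PathSystem S

Uniform₃ : ℕ → (ℕ → ℕ → ℕ → Set) → Set
Uniform₃ L A = (∀ {x y z} → x < y → y < z → z < L → A x y z) ⊎
               (∀ {x y z} → x < y → y < z → z < L → ¬ A x y z)

Uniform₄ : ℕ → (ℕ → ℕ → ℕ → ℕ → Set) → Set
Uniform₄ L A = (∀ {x y z w} → x < y → y < z → z < w → w < L → A x y z w) ⊎
               (∀ {x y z w} → x < y → y < z → z < w → w < L → ¬ A x y z w)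

-- Up to exchanging the two paths, these are the positions of two different pairs whose first
-- entries both precede both second entries, as happens between left and right indices of a
-- biclique.
record UniformSystem {V : Set} (L ℓ : ℕ) (P : ℕ → ℕ → ℕ → V) : Set where
  field
    sameStart : ∀ {k k'} → k ≤ ℓ → k' ≤ ℓ → Uniform₃ L (λ i j j' → P i j k ≡ P i j' k')
    sameEnd   : ∀ {k k'} → k ≤ ℓ → k' ≤ ℓ → Uniform₃ L (λ i i' j → P i j k ≡ P i' j k')
    crossing  : ∀ {k k'} → k ≤ ℓ → k' ≤ ℓ → Uniform₄ L (λ i i' j j' → P i j k ≡ P i' j' k')
    nested    : ∀ {k k'} → k ≤ ℓ → k' ≤ ℓ → Uniform₄ L (λ i i' j' j → P i j k ≡ P i' j' k')

module UniformPaths (em : ExcludedMiddle 0ℓ) where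
  -- An A or a B strictly inside the interval replaces the end of its kind; when none is left, the
  -- ends are as wanted. `n` is fuel bounding the length of the interval.
  adjacentChange : ∀ {A B : ℕ → Set} n a b → a ≤ b → b ≤ a + n → A a → B b →
    (∀ {k} → a ≤ k → k ≤ b → A k → B k → ⊥) →
    ∃[ k₀ ] ∃[ k₁ ] (a ≤ k₀ × k₀ < k₁ × k₁ ≤ b × A k₀ × B k₁ ×
      (∀ {k} → k₀ < k → k ≤ k₁ → ¬ A k) × (∀ {k} → k₀ ≤ k → k < k₁ → ¬ B k))
  adjacentChange {A} {B} zero a b a≤b b≤ Aa Bb excl =
    ⊥-elim (excl a≤b ≤-refl (subst A (≤-antisym a≤b (subst (b ≤_) (+-identityʳ a) b≤)) Aa) Bb)
  adjacentChange {A} {B} (suc n) a b a≤b b≤ Aa Bb excl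
    with em {P = ∃[ c ] (a < c × c < b × A c)}
  ... | yes (c , a<c , c<b , Ac) =
    let k₀ , k₁ , p , q = adjacentChange {A} {B} n c b (<⇒≤ c<b)
          (≤-trans b≤ (subst (_≤ c + n) (sym (+-suc a n)) (+-monoˡ-≤ n a<c))) Ac Bb
          (λ u → excl (≤-trans (<⇒≤ a<c) u))
    in k₀ , k₁ , ≤-trans (<⇒≤ a<c) p , q
  ... | no noA with em {P = ∃[ c ] (a < c × c < b × B c)}
  ... | yes (c , a<c , c<b , Bc) =
    let k₀ , k₁ , p , q , u , v = adjacentChange {A} {B} n a c (<⇒≤ a<c)
          (s≤s⁻¹ (≤-trans c<b (subst (b ≤_) (+-suc a n) b≤))) Aa Bc
          (λ x y → excl x (≤-trans y (<⇒≤ c<b)))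
    in k₀ , k₁ , p , q , ≤-trans u (<⇒≤ c<b) , v
  ... | no noB = a , b , ≤-refl , a<b , ≤-refl , Aa , Bb , noA' , noB'
    where
    a<b : a < b
    a<b = ≤∧≢⇒< a≤b λ { refl → excl ≤-refl ≤-refl Aa Bb }
    noA' : ∀ {k} → a < k → k ≤ b → ¬ A k
    noA' {k} a<k k≤b Ak with m≤n⇒m<n∨m≡n k≤b
    ... | inj₁ k<b  = noA (k , a<k , k<b , Ak)
    ... | inj₂ refl = excl a≤b ≤-refl Ak Bb
    noB' : ∀ {k} → a ≤ k → k < b → ¬ B k
    noB' {k} a≤k k<b Bk with m≤n⇒m<n∨m≡n a≤k
    ... | inj₁ a<k  = noB (k , a<k , k<b , Bk)
    ... | inj₂ refl = excl ≤-refl a≤b Aa Bk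

  -- Between the last position of the paths depending only on i and the next position depending only on j,
  -- uniformity makes distinct paths disjoint.
  uniformBiclique : ∀ {V : Set} {E : V → V → Set} {L ℓ P t} → 6 ≤ L → t + t * t ≤ L →
    PathSystem E L ℓ P → UniformSystem L ℓ P → ∃[ d ] (d ≤ ℓ × SubdividedBiclique E t (suc d))
  uniformBiclique {V} {E} {L} {ℓ} {P} {t} 6≤L t≤L S U = go (adjacentChange {OnlyI} {OnlyJ} ℓ 0 ℓ z≤n ≤-refl start end excl)
    where
    open PathSystem S
    open UniformSystem U
    OnlyI OnlyJ : ℕ → Set
    OnlyI k = ∀ {i j j'} → i < j → j < j' → j' < L → P i j k ≡ P i j' k
    OnlyJ k = ∀ {i i' j} → i < i' → i' < j → j < L → P i j k ≡ P i' j k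

    0<1 : 0 < 1
    0<1 = s≤s z≤n
    1<2 : 1 < 2
    1<2 = s≤s 0<1
    2<3 : 2 < 3
    2<3 = s≤s 1<2
    3<4 : 3 < 4
    3<4 = s≤s 2<3
    4<5 : 4 < 5
    4<5 = s≤s 3<4
    5<L : 5 < L
    5<L = 6≤L
    4<L : 4 < L
    4<L = <-trans 4<5 5<L
    3<L : 3 < L
    3<L = <-trans 3<4 4<L

    onlyI : ∀ {k i j j'} → k ≤ ℓ → i < j → j < j' → j' < L → P i j k ≡ P i j' k → OnlyI k
    onlyI k≤ a b c e with sameStart k≤ k≤
    ... | inj₁ all  = all
    ... | inj₂ none = ⊥-elim (none a b c e)

    onlyJ : ∀ {k i i' j} → k ≤ ℓ → i < i' → i' < j → j < L → P i j k ≡ P i' j k → OnlyJ k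
    onlyJ k≤ a b c e with sameEnd k≤ k≤
    ... | inj₁ all  = all
    ... | inj₂ none = ⊥-elim (none a b c e)

    excl : ∀ {k} → 0 ≤ k → k ≤ ℓ → OnlyI k → OnlyJ k → ⊥
    -- Position k would be the same vertex in P 0 1, P 0 3 and P 2 3, against `moves` for the pairs
    -- 0 < 1 < 2 < 3.
    excl _ k≤ I J = moves 0<1 1<2 2<3 3<L k≤ (trans (I 0<1 (<-trans 1<2 2<3) 3<L) (J (<-trans 0<1 1<2) 2<3 3<L))

    sameStart-only : ∀ {k k' i j j'} → k ≤ ℓ → k' ≤ ℓ → i < j → j < j' → j' < L →
      P i j k ≡ P i j' k' → OnlyI k × OnlyI k'
    sameStart-only k≤ k≤' a b c e with sameStart k≤ k≤'
    ... | inj₂ none = ⊥-elim (none a b c e)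
    -- Position k of P 0 1 and of P 0 2 both equal position k' of P 0 3, so k cannot depend on the
    -- second index; similarly for k'.
    ... | inj₁ all  =
      onlyI k≤ 0<1 1<2 (<-trans 2<3 3<L) (trans (all 0<1 (<-trans 1<2 2<3) 3<L) (sym (all (<-trans 0<1 1<2) 2<3 3<L))) ,
      onlyI k≤' (<-trans 0<1 1<2) 2<3 3<L (trans (sym (all 0<1 1<2 (<-trans 2<3 3<L))) (all 0<1 (<-trans 1<2 2<3) 3<L))

    sameEnd-only : ∀ {k k' i i' j} → k ≤ ℓ → k' ≤ ℓ → i < i' → i' < j → j < L →
      P i j k ≡ P i' j k' → OnlyJ k × OnlyJ k'
    sameEnd-only k≤ k≤' a b c e with sameEnd k≤ k≤'
    ... | inj₂ none = ⊥-elim (none a b c e)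
    ... | inj₁ all  =
      onlyJ k≤ 0<1 (<-trans 1<2 2<3) 3<L (trans (all (<-trans 0<1 1<2) 2<3 3<L) (sym (all 1<2 2<3 3<L))) ,
      onlyJ k≤' 1<2 2<3 3<L (trans (sym (all 0<1 (<-trans 1<2 2<3) 3<L)) (all (<-trans 0<1 1<2) 2<3 3<L))

    crossing-never : ∀ {k k' i i' j j'} → k ≤ ℓ → k' ≤ ℓ → i < i' → i' < j → j < j' → j' < L →
      P i j k ≢ P i' j' k'
    crossing-never k≤ k≤' a b c u e with crossing k≤ k≤'
    ... | inj₂ none = none a b c u e
    -- Position k of P 0 3 would equal position k' of P 1 4, P 1 5 and P 2 4, so k' would depend on
    -- neither index. The indices 0 to 5 account for 6 ≤ L.
    ... | inj₁ all  = excl z≤n k≤'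
      (onlyI k≤' (<-trans 1<2 (<-trans 2<3 3<4)) 4<5 5<L
        (trans (sym (all 0<1 (<-trans 1<2 2<3) 3<4 4<L)) (all 0<1 (<-trans 1<2 2<3) (<-trans 3<4 4<5) 5<L)))
      (onlyJ k≤' 1<2 (<-trans 2<3 3<4) 4<L
        (trans (sym (all 0<1 (<-trans 1<2 2<3) 3<4 4<L)) (all (<-trans 0<1 1<2) 2<3 3<4 4<L)))

    nested-never : ∀ {k k' i i' j j'} → k ≤ ℓ → k' ≤ ℓ → i < i' → i' < j' → j' < j → j < L →
      P i j k ≢ P i' j' k'
    nested-never k≤ k≤' a b c u e with nested k≤ k≤'
    ... | inj₂ none = none a b c u e
    ... | inj₁ all  = excl z≤n k≤'
      (onlyI k≤' (<-trans 1<2 2<3) 3<4 4<L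
        (trans (sym (all 0<1 (<-trans 1<2 2<3) (<-trans 3<4 4<5) 5<L)) (all 0<1 (<-trans 1<2 (<-trans 2<3 3<4)) 4<5 5<L)))
      (onlyJ k≤' 1<2 (<-trans 2<3 3<4) 4<L
        (trans (sym (all 0<1 (<-trans 1<2 (<-trans 2<3 3<4)) 4<5 5<L)) (all (<-trans 0<1 1<2) (<-trans 2<3 3<4) 4<5 5<L)))

    go : ∃[ k₀ ] ∃[ k₁ ] (0 ≤ k₀ × k₀ < k₁ × k₁ ≤ ℓ × OnlyI k₀ × OnlyJ k₁ ×
          (∀ {k} → k₀ < k → k ≤ k₁ → ¬ OnlyI k) × (∀ {k} → k₀ ≤ k → k < k₁ → ¬ OnlyJ k)) →
         ∃[ d ] (d ≤ ℓ × SubdividedBiclique E t (suc d))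
    go (k₀ , k₁ , _ , k₀<k₁ , k₁≤ , I₀ , J₁ , noI , noJ) with m≤n⇒∃[o]m+o≡n k₀<k₁
    ... | d , refl = d , ≤-trans (≤-trans (m≤n+m d k₀) (n≤1+n (k₀ + d))) k₁≤ , record
      { pt       = λ i b q → P i b (k₀ + q)
      ; pt-start = λ {i} {b} {b'} i< rb rb' → subst (λ k → P i b k ≡ P i b' k) (sym (+-identityʳ k₀)) (row i< rb rb')
      ; pt-end   = λ {i} {i'} {b} i< i<' rb → subst (λ k → P i b k ≡ P i' b k) (sym (+-suc k₀ d)) (column i< i<' rb)
      ; pt-edge  = λ {i} {b} {q} i< rb q< → subst (λ k → E (P i b (k₀ + q)) (P i b k)) (sym (+-suc k₀ q))
                     (edge (left i< rb) (right rb) (≤-trans (subst (_≤ k₁) (+-suc k₀ q) (scale q<)) k₁≤))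
      ; pt-inj   = λ {i} {b} {q} {i'} {b'} {q'} i< rb q≤ i<' rb' q≤' e →
          let p₁ , p₂ , p₃ = separate i< rb (m≤m+n k₀ q) (scale q≤) i<' rb' (m≤m+n k₀ q') (scale q≤') e
          in +-cancelˡ-≡ k₀ q q' p₁ ,
             (λ q<d → p₂ (subst (k₀ + q <_) (+-suc k₀ d) (+-monoʳ-< k₀ q<d))) ,
             (λ 0<q → p₃ (m<m+n k₀ 0<q))
      }
      where
      Right : ℕ → Set
      Right b = t ≤ b × b < t + t * t
      left : ∀ {i b} → i < t → Right b → i < b
      left i< (t≤b , _) = <-≤-trans i< t≤b
      right : ∀ {b} → Right b → b < L
      right (_ , b<) = <-≤-trans b< t≤L
      scale : ∀ {q} → q ≤ suc d → k₀ + q ≤ k₁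
      scale {q} q≤ = subst (k₀ + q ≤_) (+-suc k₀ d) (+-monoʳ-≤ k₀ q≤)

      row : ∀ {i b b'} → i < t → Right b → Right b' → P i b k₀ ≡ P i b' k₀
      row {i} {b} {b'} i< rb rb' with <-cmp b b'
      ... | tri< lt _ _   = I₀ (left i< rb) lt (right rb')
      ... | tri≈ _ refl _ = refl
      ... | tri> _ _ gt   = sym (I₀ (left i< rb') gt (right rb))

      column : ∀ {i i' b} → i < t → i' < t → Right b → P i b k₁ ≡ P i' b k₁
      column {i} {i'} {b} i< i<' rb with <-cmp i i'
      ... | tri< lt _ _   = J₁ lt (left i<' rb) (right rb)
      ... | tri≈ _ refl _ = refl
      ... | tri> _ _ gt   = sym (J₁ gt (left i< rb) (right rb))

      atStart : ∀ {k} → k₀ ≤ k → k ≤ k₁ → OnlyI k → k ≡ k₀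
      atStart k₀≤ ≤k₁ I with m≤n⇒m<n∨m≡n k₀≤
      ... | inj₁ lt = ⊥-elim (noI lt ≤k₁ I)
      ... | inj₂ eq = sym eq

      atEnd : ∀ {k} → k₀ ≤ k → k ≤ k₁ → OnlyJ k → k ≡ k₁
      atEnd k₀≤ ≤k₁ J with m≤n⇒m<n∨m≡n ≤k₁
      ... | inj₁ lt = ⊥-elim (noJ k₀≤ lt J)
      ... | inj₂ eq = eq

      Separated : ℕ → ℕ → ℕ → ℕ → ℕ → ℕ → Set
      Separated i b k i' b' k' = k ≡ k' × (k < k₁ → i ≡ i') × (k₀ < k → b ≡ b')

      separate-sameI : ∀ {i b k b' k'} → i < t → Right b → k₀ ≤ k → k ≤ k₁ → Right b' → k₀ ≤ k' → k' ≤ k₁ →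
        b < b' → P i b k ≡ P i b' k' → k ≡ k₀ × k' ≡ k₀
      separate-sameI i< rb u v rb' u' v' lt e =
        let I , I' = sameStart-only (≤-trans v k₁≤) (≤-trans v' k₁≤) (left i< rb) lt (right rb') e
        in atStart u v I , atStart u' v' I'

      separate-sameJ : ∀ {i b k i' k'} → i < t → Right b → k₀ ≤ k → k ≤ k₁ → i' < t → k₀ ≤ k' → k' ≤ k₁ →
        i < i' → P i b k ≡ P i' b k' → k ≡ k₁ × k' ≡ k₁
      separate-sameJ i< rb u v i<' u' v' lt e =
        let J , J' = sameEnd-only (≤-trans v k₁≤) (≤-trans v' k₁≤) lt (left i<' rb) (right rb) e
        in atEnd u v J , atEnd u' v' J'

      separate-< : ∀ {i b k i' b' k'} → Right b → k ≤ k₁ → i' < t → Right b' → k' ≤ k₁ →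
        i < i' → b ≢ b' → P i b k ≢ P i' b' k'
      separate-< {b = b} {b' = b'} rb v i<' rb' v' lt b≢ with <-cmp b b'
      ... | tri< lb _ _ = crossing-never (≤-trans v k₁≤) (≤-trans v' k₁≤) lt (left i<' rb) lb (right rb')
      ... | tri≈ _ eq _ = λ _ → b≢ eq
      ... | tri> _ _ gb = nested-never (≤-trans v k₁≤) (≤-trans v' k₁≤) lt (left i<' rb') gb (right rb)

      separate : ∀ {i b k i' b' k'} → i < t → Right b → k₀ ≤ k → k ≤ k₁ → i' < t → Right b' → k₀ ≤ k' → k' ≤ k₁ →
        P i b k ≡ P i' b' k' → Separated i b k i' b' k'
      separate {i} {b} {k} {i'} {b'} {k'} i< rb u v i<' rb' u' v' e with <-cmp i i' | <-cmp b b'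
      ... | tri≈ _ refl _ | tri≈ _ refl _ =
        inj (left i< rb) (right rb) (≤-trans v k₁≤) (≤-trans v' k₁≤) e , (λ _ → refl) , (λ _ → refl)
      ... | tri≈ _ refl _ | tri< lt _ _ =
        let p , q = separate-sameI i< rb u v rb' u' v' lt e
        in trans p (sym q) , (λ _ → refl) , λ lk → ⊥-elim (<-irrefl (sym p) lk)
      ... | tri≈ _ refl _ | tri> _ _ gt =
        let q , p = separate-sameI i< rb' u' v' rb u v gt (sym e)
        in trans p (sym q) , (λ _ → refl) , λ lk → ⊥-elim (<-irrefl (sym p) lk)
      ... | tri< lt _ _ | tri≈ _ refl _ =
        let p , q = separate-sameJ i< rb u v i<' u' v' lt e
        in trans p (sym q) , (λ lk → ⊥-elim (<-irrefl p lk)) , (λ _ → refl)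
      ... | tri> _ _ gt | tri≈ _ refl _ =
        let q , p = separate-sameJ i<' rb u' v' i< u v gt (sym e)
        in trans p (sym q) , (λ lk → ⊥-elim (<-irrefl p lk)) , (λ _ → refl)
      ... | tri< lt _ _ | tri< _ b≢ _ = ⊥-elim (separate-< rb v i<' rb' v' lt b≢ e)
      ... | tri< lt _ _ | tri> _ b≢ _ = ⊥-elim (separate-< rb v i<' rb' v' lt b≢ e)
      ... | tri> _ _ gt | tri< _ b≢ _ = ⊥-elim (separate-< rb' v' i< rb v gt (b≢ ∘ sym) (sym e))
      ... | tri> _ _ gt | tri> _ b≢ _ = ⊥-elim (separate-< rb' v' i< rb v gt (b≢ ∘ sym) (sym e))

module SparsePaths (em : ExcludedMiddle 0ℓ) where
  open Ramsey em
  open UniformPaths em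

  abstract
    ramseyFamily₂ : ∀ k c c' m → ∃[ N ] (∀ {X : Set} (P : Fin c → Fin c' → Pred X k) xs → N ≤ length xs →
      ∃[ ys ] (ys ⊆ xs × m ≤ length ys × (∀ e e' → Homog k (P e e') ys)))
    ramseyFamily₂ k c c' m with ramseyFamily k (c * c') m
    ... | N , fam = N , λ P xs le →
      let ys , τ , l , h = fam (λ e → uncurry P (remQuot c' e)) xs le
      in ys , τ , l , λ e e' → subst (λ z → Homog k (uncurry P z) ys) (remQuot-combine e e') (h (combine e e'))

  Homog⇒Uniform₃ : ∀ {A : ℕ → ℕ → ℕ → Set} {L} ys → L ≤ length ys → Homog 3 A ys →
    Uniform₃ L (λ i j k → A (nth 0 ys i) (nth 0 ys j) (nth 0 ys k))
  Homog⇒Uniform₃ ys le = ⊎-map (λ h a b c → nth₃ 0 ys h a b (<-≤-trans c le)) (λ h a b c → nth₃ 0 ys h a b (<-≤-trans c le))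

  Homog⇒Uniform₄ : ∀ {A : ℕ → ℕ → ℕ → ℕ → Set} {L} ys → L ≤ length ys → Homog 4 A ys →
    Uniform₄ L (λ i j k m → A (nth 0 ys i) (nth 0 ys j) (nth 0 ys k) (nth 0 ys m))
  Homog⇒Uniform₄ ys le = ⊎-map (λ h a b c d → nth₄ 0 ys h a b c (<-≤-trans d le)) (λ h a b c d → nth₄ 0 ys h a b c (<-≤-trans d le))

  abstract
    upperBound : ∀ (f : ℕ → ℕ) n → ∃[ t ] (∀ {i} → i ≤ n → f i ≤ t)
    upperBound f zero = f 0 , λ { z≤n → ≤-refl }
    upperBound f (suc n) with upperBound f n
    ... | t , b = t ⊔ f (suc n) , go
      where
      go : ∀ {i} → i ≤ suc n → f i ≤ t ⊔ f (suc n)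
      go {i} le with m≤n⇒m<n∨m≡n le
      ... | inj₁ lt   = ≤-trans (b (s≤s⁻¹ lt)) (m≤m⊔n t _)
      ... | inj₂ refl = m≤n⊔m t _

  Sparse : (ℕ → ℕ) → {V : Set} → (V → V → Set) → Set
  Sparse f E = (∀ {x y} → E x y → E y x) × (∀ r → ¬ SubdEmbedding (f r) r E)

  abstract
    noPathSystem : ∀ f ℓ → ∃[ n ] (∀ {V : Set} {E : V → V → Set} → Sparse f E → ∀ P → ¬ PathSystem E n ℓ P)
    -- The segment found has length suc d for some unknown d ≤ ℓ and yields a clique subdivided d +
    -- suc d times, so t must dominate f on the whole range. One Ramsey bound per pattern of
    -- coincidence follows, with one colour class for every two positions.
    noPathSystem f ℓ with upperBound f (ℓ + suc ℓ)
    ... | t , f≤t with ramseyFamily₂ 4 (suc ℓ) (suc ℓ) (6 + (t + t * t))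
    ... | n₁ , ram₁ with ramseyFamily₂ 4 (suc ℓ) (suc ℓ) n₁
    ... | n₂ , ram₂ with ramseyFamily₂ 3 (suc ℓ) (suc ℓ) n₂
    ... | n₃ , ram₃ with ramseyFamily₂ 3 (suc ℓ) (suc ℓ) n₃
    ... | n , ram₄ = n , contra
      where
      L : ℕ
      L = 6 + (t + t * t)

      contra : ∀ {V : Set} {E : V → V → Set} → Sparse f E → ∀ P → ¬ PathSystem E n ℓ P
      contra {V} {E} (E-sym , noSub) P S
        with ram₄ (λ k k' i j j' → P i j (toℕ k) ≡ P i j' (toℕ k')) (range 0 n) (≤-reflexive (sym (length-range 0 n)))
      ... | ys₄ , τ₄ , l₄ , h₄ with ram₃ (λ k k' i i' j → P i j (toℕ k) ≡ P i' j (toℕ k')) ys₄ l₄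
      ... | ys₃ , τ₃ , l₃ , h₃ with ram₂ (λ k k' i i' j j' → P i j (toℕ k) ≡ P i' j' (toℕ k')) ys₃ l₃
      ... | ys₂ , τ₂ , l₂ , h₂ with ram₁ (λ k k' i i' j' j → P i j (toℕ k) ≡ P i' j' (toℕ k')) ys₂ l₂
      ... | ys , τ₁ , l₁ , h₁ = finish (uniformBiclique {t = t} (m≤m+n 6 _) (m≤n+m _ 6) S' U)
        where
        y : ℕ → ℕ
        y = nth 0 ys
        ys⊆ys₃ : ys ⊆ ys₃
        ys⊆ys₃ = ⊆-trans τ₁ τ₂
        ys⊆ys₄ : ys ⊆ ys₄
        ys⊆ys₄ = ⊆-trans ys⊆ys₃ τ₃
        ys⊆range : ys ⊆ range 0 n
        ys⊆range = ⊆-trans ys⊆ys₄ τ₄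

        indexed : ∀ (A : ℕ → ℕ → Set) → (∀ (k k' : Fin (suc ℓ)) → A (toℕ k) (toℕ k')) →
          ∀ {k k'} → k ≤ ℓ → k' ≤ ℓ → A k k'
        indexed A h k≤ k≤' = subst₂ A (toℕ-fromℕ< (s≤s k≤)) (toℕ-fromℕ< (s≤s k≤')) (h (fromℕ< (s≤s k≤)) (fromℕ< (s≤s k≤')))

        S' : PathSystem E L ℓ (λ i j → P (y i) (y j))
        S' = restrict y
          (λ i<j j<L → nth₂ 0 ys (AllSub-⊆ 2 ys⊆range (range-increasing 0 n)) i<j (<-≤-trans j<L l₁))
          (λ i<L → proj₂ (nth₁ 0 ys (AllSub-⊆ 1 ys⊆range (range-bounds 0 n)) (<-≤-trans i<L l₁)))
          S

        U : UniformSystem L ℓ (λ i j → P (y i) (y j))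
        U = record
          { sameStart = indexed (λ k k' → Uniform₃ L (λ i j j' → P (y i) (y j) k ≡ P (y i) (y j') k'))
                          λ k k' → Homog⇒Uniform₃ ys l₁ (Homog-⊆ 3 ys⊆ys₄ (h₄ k k'))
          ; sameEnd   = indexed (λ k k' → Uniform₃ L (λ i i' j → P (y i) (y j) k ≡ P (y i') (y j) k'))
                          λ k k' → Homog⇒Uniform₃ ys l₁ (Homog-⊆ 3 ys⊆ys₃ (h₃ k k'))
          ; crossing  = indexed (λ k k' → Uniform₄ L (λ i i' j j' → P (y i) (y j) k ≡ P (y i') (y j') k'))
                          λ k k' → Homog⇒Uniform₄ ys l₁ (Homog-⊆ 4 τ₁ (h₂ k k'))
          ; nested    = indexed (λ k k' → Uniform₄ L (λ i i' j' j → P (y i) (y j) k ≡ P (y i') (y j') k'))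
                          λ k k' → Homog⇒Uniform₄ ys l₁ (h₁ k k')
          }

        finish : ¬ (∃[ d ] (d ≤ ℓ × SubdividedBiclique E t (suc d)))
        finish (d , d≤ℓ , B) = noSub (d + suc d) (subdividedClique E-sym B (f (d + suc d))
          (f≤t (+-mono-≤ d≤ℓ (s≤s d≤ℓ))))

-- Walks avoiding a set, and quasi-wideness

AllSub-map₁ : ∀ {X} {P Q : Pred X 1} xs → (∀ {x} → P x → Q x) → AllSub 1 P xs → AllSub 1 Q xs
AllSub-map₁ []       f h       = tt
AllSub-map₁ (x ∷ xs) f (p , h) = f p , AllSub-map₁ xs f h

AllSub-map₂ : ∀ {X} {P Q : Pred X 2} xs → (∀ {x y} → P x y → Q x y) → AllSub 2 P xs → AllSub 2 Q xs
AllSub-map₂ []       f h       = tt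
AllSub-map₂ (x ∷ xs) f (p , h) = AllSub-map₁ xs f p , AllSub-map₂ xs f h

AllSub-zip₁ : ∀ {X} {P Q : Pred X 1} xs → AllSub 1 P xs → AllSub 1 Q xs → AllSub 1 (λ x → P x × Q x) xs
AllSub-zip₁ []       _       _       = tt
AllSub-zip₁ (x ∷ xs) (p , h) (q , g) = (p , q) , AllSub-zip₁ xs h g

AllSub-zip₂ : ∀ {X} {P Q : Pred X 2} xs → AllSub 2 P xs → AllSub 2 Q xs → AllSub 2 (λ x y → P x y × Q x y) xs
AllSub-zip₂ []       _       _       = tt
AllSub-zip₂ (x ∷ xs) (p , h) (q , g) = AllSub-zip₁ xs p q , AllSub-zip₂ xs h g

AllSub₁-∈ : ∀ {X : Set} {P : X → Set} xs → (∀ {x} → x ∈ xs → P x) → AllSub 1 P xs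
AllSub₁-∈ []       h = tt
AllSub₁-∈ (x ∷ xs) h = h (here refl) , AllSub₁-∈ xs (h ∘ there)

-- Turns a property of pairs into one of single points, at the cost of the last point, which has no
-- successor.
initial : ∀ {X} {P : Pred X 2} xs → AllSub 2 P xs →
  ∃[ ys ] (ys ⊆ xs × length xs ≤ suc (length ys) × AllSub 1 (λ x → ∃[ y ] P x y) ys)
initial []           _       = [] , [] , z≤n , tt
initial (x ∷ [])     _       = [] , x ∷ʳ [] , s≤s z≤n , tt
initial (x ∷ y ∷ xs) ((p , _) , h) with initial (y ∷ xs) h
... | ys , τ , l , g = x ∷ ys , refl ∷ τ , s≤s l , (y , p) , g

module _ {V : Set} (E : V → V → Set) (S : List V) where

  data Walk : ℕ → V → V → Set where
    stop : ∀ {a} → a ∉ S → Walk 0 a a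
    step : ∀ {n a b c} → a ∉ S → E a b → Walk n b c → Walk (suc n) a c

  -- The inequality is strict, so the distance is at least r. Walks avoid S at their ends too, so a
  -- point of S is far from everything, itself included.
  Far : ℕ → V → V → Set
  Far r a b = ∀ {n} → n < r → ¬ Walk n a b

module _ {V : Set} {E : V → V → Set} {S : List V} where

  start∉ : ∀ {n a b} → Walk E S n a b → a ∉ S
  start∉ (stop p)     = p
  start∉ (step p _ _) = p

  at : ∀ {n a b} → Walk E S n a b → ℕ → V
  at {a = a} _            zero    = a
  at {a = a} (stop _)     (suc _) = a
  at         (step _ _ w) (suc k) = at w k

  at-end : ∀ {n a b} (w : Walk E S n a b) → at w n ≡ b
  at-end (stop _)     = refl
  at-end (step _ _ w) = at-end w

  at-edge : ∀ {n a b} (w : Walk E S n a b) {k} → k < n → E (at w k) (at w (suc k))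
  at-edge (step _ e (stop _))     {zero} _        = e
  at-edge (step _ e (step _ _ _)) {zero} _        = e
  at-edge (step _ _ w)            {suc k} (s≤s l) = at-edge w l

  takeWalk : ∀ {n a b} (w : Walk E S n a b) {k} → k ≤ n → Walk E S k a (at w k)
  takeWalk w            {zero}  _       = stop (start∉ w)
  takeWalk (step p e w) {suc k} (s≤s l) = step p e (takeWalk w l)

  dropWalk : ∀ {n a b} (w : Walk E S n a b) {k} → k ≤ n → Walk E S (n ∸ k) (at w k) b
  dropWalk w            {zero}  _       = w
  dropWalk (step p e w) {suc k} (s≤s l) = dropWalk w l

  _⊕_ : ∀ {n m a b c} → Walk E S n a b → Walk E S m b c → Walk E S (n + m) a c
  stop _     ⊕ w' = w'
  step p e w ⊕ w' = step p e (w ⊕ w')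

  shortcut : ∀ {n a b} (w : Walk E S n a b) {k k'} → k < k' → k' ≤ n → at w k ≡ at w k' →
    ∃[ n' ] (n' < n × Walk E S n' a b)
  shortcut {n} w {k} {k'} k<k' k'≤n e =
    k + (n ∸ k') , subst (k + (n ∸ k') <_) (m+[n∸m]≡n k'≤n) (+-monoˡ-< (n ∸ k') k<k') ,
    (subst (Walk E S k _) e (takeWalk w (≤-trans (<⇒≤ k<k') k'≤n)) ⊕ dropWalk w k'≤n)

  -- Cutting out the loop between two visits to a vertex would shorten the walk.
  at-injective : ∀ {n a b} (w : Walk E S n a b) → (∀ {n'} → n' < n → ¬ Walk E S n' a b) →
    ∀ {k k'} → k ≤ n → k' ≤ n → at w k ≡ at w k' → k ≡ k'
  at-injective w shortest {k} {k'} k≤ k'≤ e with <-cmp k k'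
  ... | tri≈ _ eq _ = eq
  ... | tri< lt _ _ = let _ , l , w' = shortcut w lt k'≤ e in ⊥-elim (shortest l w')
  ... | tri> _ _ gt = let _ , l , w' = shortcut w gt k≤ (sym e) in ⊥-elim (shortest l w')

  module _ (E-sym : ∀ {x y} → E x y → E y x) where
    join : ∀ {n m a b c} → Walk E S n a b → Walk E S m a c → Walk E S (n + m) b c
    join (stop _)     w' = w'
    join {suc n} {m} {b = b} {c = c} (step _ e w) w' = subst (λ l → Walk E S l b c) (+-suc n m) (join w (step (start∉ w) (E-sym e) w'))

    reverse : ∀ {n a b} → Walk E S n a b → Walk E S n b a
    reverse {n} w = subst (λ l → Walk E S l _ _) (+-identityʳ n) (join w (stop (start∉ w)))

  end∉ : ∀ {n a b} → Walk E S n a b → b ∉ S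
  end∉ (stop p)     = p
  end∉ (step _ _ w) = end∉ w

weaken : ∀ {V : Set} {E : V → V → Set} {S S'} → (∀ {x} → x ∈ S → x ∈ S') →
  ∀ {n a b} → Walk E S' n a b → Walk E S n a b
weaken sub (stop p)     = stop (p ∘ sub)
weaken sub (step p e w) = step (p ∘ sub) e (weaken sub w)

Scattered : ∀ {V : Set} (E : V → V → Set) → ℕ → List V → ∀ {X : Set} → (X → V) → List X → Set
Scattered E r S col = AllSub 2 (λ x y → Far E S r (col x) (col y))

Far-weaken : ∀ {V : Set} {E : V → V → Set} {S S'} → (∀ {x} → x ∈ S → x ∈ S') →
  ∀ {r a b} → Far E S r a b → Far E S' r a b
Far-weaken sub far l w = far l (weaken sub w)

Scattered-weaken : ∀ {V : Set} {E : V → V → Set} {S S' r} {X : Set} {col : X → V} xs → (∀ {x} → x ∈ S → x ∈ S') →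
  Scattered E r S col xs → Scattered E r S' col xs
Scattered-weaken {E = E} {S} {S'} {r} {col = col} xs sub =
  AllSub-map₂ {P = λ x y → Far E S r (col x) (col y)} {Q = λ x y → Far E S' r (col x) (col y)} xs (λ {x} {y} far {n} → Far-weaken sub {r} far {n})

-- Uniform quasi-wideness, by induction on the distance

module QuasiWideness (em : ExcludedMiddle 0ℓ) where
  open Ramsey em
  open SparsePaths em

  module _ {V : Set} (E : V → V → Set) (S : List V) where
    -- Choosing the walk by `em` makes its vertices a function of length and endpoints, as Ramsey
    -- colourings require; if there is no walk, the value is arbitrary.
    path : ℕ → V → V → ℕ → V
    path n a b k with em {P = Walk E S n a b}
    ... | yes w = at w k
    ... | no _  = a

    path-walk : ∀ {n a b} → Walk E S n a b → Σ[ w ∈ Walk E S n a b ] (∀ k → path n a b k ≡ at w k)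
    path-walk {n} {a} {b} w with em {P = Walk E S n a b}
    ... | yes w' = w' , λ _ → refl
    ... | no ¬w  = ⊥-elim (¬w w)

    path-edge : ∀ {n a b} → Walk E S n a b → ∀ {k} → k < n → E (path n a b k) (path n a b (suc k))
    path-edge w {k} k<n with path-walk w
    ... | w' , e = subst₂ E (sym (e k)) (sym (e (suc k))) (at-edge w' k<n)

    path-end : ∀ {n a b} → Walk E S n a b → path n a b n ≡ b
    path-end {n} w with path-walk w
    ... | w' , e = trans (e n) (at-end w')

    path-start : ∀ {n a b} → Walk E S n a b → path n a b 0 ≡ a
    path-start w with path-walk w
    ... | w' , e = e 0

    path-take : ∀ {n a b} → Walk E S n a b → ∀ {k} → k ≤ n → Walk E S k a (path n a b k)
    path-take w {k} k≤n with path-walk w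
    ... | w' , e = subst (Walk E S k _) (sym (e k)) (takeWalk w' k≤n)

    path-drop : ∀ {n a b} → Walk E S n a b → ∀ {k} → k ≤ n → Walk E S (n ∸ k) (path n a b k) b
    path-drop {n} w {k} k≤n with path-walk w
    ... | w' , e = subst (λ z → Walk E S (n ∸ k) z _) (sym (e k)) (dropWalk w' k≤n)

    path-inj : ∀ {n a b} → Walk E S n a b → Far E S n a b →
      ∀ {k k'} → k ≤ n → k' ≤ n → path n a b k ≡ path n a b k' → k ≡ k'
    path-inj w far {k} {k'} k≤ k'≤ eq with path-walk w
    ... | w' , e = at-injective w' far k≤ k'≤ (trans (sym (e k)) (trans eq (e k')))

  module _ {V : Set} {E : V → V → Set} (E-sym : ∀ {x y} → E x y → E y x) {X : Set} (col : X → V) where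

    -- Hub paths are geodesic: a shorter walk from a hub to one point, joined to a hub path to
    -- another point, would bring the two points closer than h + h = r. For the same reason paths to
    -- different points do not meet at equal positions after the start, and at the start the hubs
    -- differ.
    hubSystem : ∀ {S r h} (d : X) (v₀ : V) xs vs n → n ≤ length xs → n ≤ length vs → h + h ≡ r →
      Scattered E r S col xs → AllSub 2 _≢_ vs →
      AllSub 1 (λ v → AllSub 1 (λ x → Walk E S h v (col x)) xs) vs →
      PathSystem E n h (λ i j → path E S h (nth v₀ vs i) (col (nth d xs j)))
    hubSystem {S} {r} {h} d v₀ xs vs n n≤xs n≤vs refl scat dist hubs = record
      { start = λ a b c → trans (path-start E S (w (<-trans (<-trans a b) c) (<-trans b c)))
                                (sym (path-start E S (w (<-trans (<-trans a b) c) c)))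
      ; end   = λ a b c → trans (path-end E S (w (<-trans a (<-trans b c)) c)) (sym (path-end E S (w (<-trans b c) c)))
      ; edge  = λ a b → path-edge E S (w (<-trans a b) b)
      ; inj   = λ a b → path-inj E S (w (<-trans a b) b) (near a b)
      ; moves = moves'
      }
      where
      w : ∀ {i j} → i < n → j < n → Walk E S h (nth v₀ vs i) (col (nth d xs j))
      w i< j< = nth₁ d xs (nth₁ v₀ vs hubs (<-≤-trans i< n≤vs)) (<-≤-trans j< n≤xs)
      far : ∀ {i j} → i < j → j < n → Far E S (h + h) (col (nth d xs i)) (col (nth d xs j))
      far i<j j<n = nth₂ d xs scat i<j (<-≤-trans j<n n≤xs)
      near : ∀ {i j} → i < j → j < n → Far E S h (nth v₀ vs i) (col (nth d xs j))
      near {i} {suc j} i<j j<n l u =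
        far {0} {suc j} (s≤s z≤n) j<n (+-monoʳ-< h l) (join E-sym (w (<-trans i<j j<n) (≤-<-trans z≤n j<n)) u)
      moves' : ∀ {i j i' j' k} → i < j → j < i' → i' < j' → j' < n → k ≤ h →
        path E S h (nth v₀ vs i) (col (nth d xs j)) k ≢ path E S h (nth v₀ vs i') (col (nth d xs j')) k
      moves' {k = zero} a b c l _ e =
        nth₂ v₀ vs dist (<-trans a b) (<-≤-trans (<-trans c l) n≤vs)
          (trans (sym (path-start E S (w (<-trans (<-trans a b) (<-trans c l)) (<-trans b (<-trans c l)))))
            (trans e (path-start E S (w (<-trans c l) l))))
      moves' {i} {j} {i'} {j'} {suc k} a b c l k≤h e =
        far (<-trans b c) l (+-mono-< h∸k<h h∸k<h)
          (join E-sym (subst (λ z → Walk E S (h ∸ suc k) z _) e (path-drop E S (w (<-trans (<-trans a b) (<-trans c l)) (<-trans b (<-trans c l))) k≤h))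
                (path-drop E S (w (<-trans c l) l) k≤h))
        where
        h∸k<h : h ∸ suc k < h
        h∸k<h = ∸-monoʳ-< {h} {suc k} {0} (s≤s z≤n) k≤h

    scatteredSystem : ∀ {T r} (d : X) xs n → n ≤ length xs →
      Scattered E r T col xs → AllSub 2 (λ x y → Walk E T r (col x) (col y)) xs →
      (∀ {k} → k ≤ r → AllSub 4 (λ x y x' y' → path E T r (col x) (col y) k ≢ path E T r (col x') (col y') k) xs) →
      PathSystem E n r (λ i j → path E T r (col (nth d xs i)) (col (nth d xs j)))
    scatteredSystem {T} {r} d xs n n≤xs scat walks moves = record
      { start = λ a b c → trans (path-start E T (w a (<-trans b c))) (sym (path-start E T (w (<-trans a b) c)))
      ; end   = λ a b c → trans (path-end E T (w (<-trans a b) c)) (sym (path-end E T (w b c)))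
      ; edge  = λ a b → path-edge E T (w a b)
      ; inj   = λ a b → path-inj E T (w a b) (nth₂ d xs scat a (<-≤-trans b n≤xs))
      ; moves = λ a b c l k≤r → nth₄ d xs (moves k≤r) a b c (<-≤-trans l n≤xs)
      }
      where
      w : ∀ {i j} → i < j → j < n → Walk E T r (col (nth d xs i)) (col (nth d xs j))
      w i<j j<n = nth₂ d xs walks i<j (<-≤-trans j<n n≤xs)

  Scattering : (f : ℕ → ℕ) (r s m N : ℕ) → Set₁
  Scattering f r s m N = ∀ {V : Set} {E : V → V → Set} → Sparse f E → ∀ {X : Set} (col : X → V) xs → N ≤ length xs →
    ∃[ S ] ∃[ ys ] (length S ≤ s × ys ⊆ xs × m ≤ length ys × Scattered E r S col ys)

  -- `s` is chosen before `m`: how many points are needed for two of them to agree in type over S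
  -- depends on the size of S.
  QuasiWide : (ℕ → ℕ) → Set₁
  QuasiWide f = ∀ r → ∃[ s ] ∀ m → ∃ (Scattering f r s m)

  module ScatteringStep (f : ℕ → ℕ) (r m : ℕ) where
    h n t : ℕ
    h = ⌊ r /2⌋
    n = proj₁ (noPathSystem f h)
    -- One more than `n` makes the lists nonempty, so that their heads can serve as defaults for
    -- `nth`.
    t = suc n

    -- The equation h + h ≡ r belongs to each hub, so that nothing is asserted about the parity of r
    -- before the first hub appears.
    Hubs : ∀ {V : Set} (E : V → V → Set) (S : List V) {X : Set} (col : X → V) → List X → List V → Set
    Hubs E S col xs = AllSub 1 (λ v → h + h ≡ r × AllSub 1 (λ x → Walk E S h v (col x)) xs)

    -- `τ` is the number of hubs still to be found before their system becomes too large. Distances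
    -- and hub paths avoid S alone, since the paths start at the hubs; deletion of further vertices
    -- is left to the conclusion.
    Refinement : ℕ → ℕ → Set₁
    Refinement τ N = ∀ {V : Set} {E : V → V → Set} → Sparse f E → ∀ {X : Set} (col : X → V) S xs vs →
      N ≤ length xs → t ≤ length vs + τ → Scattered E r S col xs → AllSub 2 _≢_ vs → Hubs E S col xs vs →
      ∃[ S' ] ∃[ ys ] (length S' ≤ length vs + τ × ys ⊆ xs × m ≤ length ys × Scattered E (suc r) (S' ++ S) col ys)

    tooManyHubs : Refinement 0 t
    tooManyHubs sp col S (x ∷ xs) (v ∷ vs) n≤xs t≤vs scat dist hubs =
      ⊥-elim (proj₂ (noPathSystem f h) sp _ (hubSystem (proj₁ sp) col x v (x ∷ xs) (v ∷ vs) n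
        (<⇒≤ n≤xs) (<⇒≤ (subst (t ≤_) (+-identityʳ _) t≤vs)) (proj₁ (proj₁ hubs)) scat dist (AllSub-map₁ (v ∷ vs) proj₂ hubs)))

    -- A vertex v lying at position k of all the paths P x y is at distance k from all x and r - k from all y, whence r = 2k.
    newHub : ∀ {V : Set} {E : V → V → Set} → (∀ {x y} → E x y → E y x) → ∀ {X : Set} (col : X → V) {T} xs {k} →
      4 ≤ length xs → k ≤ r → Scattered E r T col xs → AllSub 2 (λ x y → Walk E T r (col x) (col y)) xs →
      AllSub 4 (λ x y x' y' → path E T r (col x) (col y) k ≡ path E T r (col x') (col y') k) xs →
      ∃[ v ] ∃[ ys ] (v ∉ T × ys ⊆ xs × length xs ≤ 3 + length ys × h + h ≡ r × AllSub 1 (λ x → Walk E T h v (col x)) ys)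
    newHub {E = E} E-sym col {T} (x₀ ∷ x₁ ∷ x₂ ∷ x₃ ∷ xs) {k} (s≤s (s≤s (s≤s (s≤s _)))) k≤r
      ((_ , far₀₂ , _) , (_ , far₁₃ , _) , _) ((w₀₁ , _) , _ , walks) ((same , _) , _)
      with initial (x₂ ∷ x₃ ∷ xs) (AllSub-zip₂ (x₂ ∷ x₃ ∷ xs) walks same)
    ... | ys , τ , l , next =
      v , ys , start∉ (path-drop E T w₀₁ k≤r) , x₀ ∷ʳ (x₁ ∷ʳ τ) , s≤s (s≤s l) , h+h≡r ,
      AllSub-map₁ ys (λ { (y , w , e) → subst (λ l → Walk E T l v _) (sym h≡k)
        (reverse E-sym (subst (Walk E T k _) (sym e) (path-take E T w k≤r))) }) next
      where
      v = path E T r (col x₀) (col x₁) k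
      w₂₃ : Walk E T r (col x₂) (col x₃)
      w₂₃ = proj₁ (proj₁ walks)
      v≡ : v ≡ path E T r (col x₂) (col x₃) k
      v≡ = proj₁ (proj₁ same)
      u = r ∸ k
      k+u≡r : k + u ≡ r
      k+u≡r = m+[n∸m]≡n k≤r
      k+k≥r : ¬ k + k < r
      k+k≥r l = far₀₂ l (path-take E T w₀₁ k≤r ⊕ reverse E-sym (subst (Walk E T k _) (sym v≡) (path-take E T w₂₃ k≤r)))
      u+u≥r : ¬ u + u < r
      u+u≥r l = far₁₃ l (join E-sym (path-drop E T w₀₁ k≤r) (subst (λ z → Walk E T u z _) (sym v≡) (path-drop E T w₂₃ k≤r)))
      k≡u : k ≡ u
      k≡u = ≤-antisym
        (+-cancelʳ-≤ u k u (subst (_≤ u + u) (sym k+u≡r) (≮⇒≥ u+u≥r)))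
        (+-cancelˡ-≤ k u k (subst (_≤ k + k) (sym k+u≡r) (≮⇒≥ k+k≥r)))
      k+k≡r : k + k ≡ r
      k+k≡r = trans (cong (k +_) k≡u) k+u≡r
      h≡k : h ≡ k
      h≡k = trans (cong ⌊_/2⌋ (sym k+k≡r)) (sym (n≡⌊n+n/2⌋ k))
      h+h≡r : h + h ≡ r
      h+h≡r = subst (λ z → z + z ≡ r) (sym h≡k) k+k≡r

    -- With the hubs deleted, Ramsey leaves either no pair joined by a walk of length r, and the
    -- hubs suffice, or only joined pairs. In the second case some position is common to the paths
    -- of disjoint pairs and gives a new hub, as otherwise the paths would form a forbidden system.
    refine : ∀ τ → ∃ (Refinement τ)
    refine zero    = t , tooManyHubs
    refine (suc τ) with refine τ
    ... | N' , rec with noPathSystem f r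
    -- `noSystem` takes `n₁` points; `newHub` takes four or more and keeps all but three, which
    -- leaves `N'` for the recursion.
    ... | n₁ , noSystem with ramseyFamily 4 (suc r) (n₁ + (4 + N'))
    ... | N₄ , ram₄ with ramsey 2 (m + N₄)
    ... | N₂ , ram₂ = N₂ , go
      where
      go : Refinement (suc τ) N₂
      go {V} {E} sp {X} col S xs vs N≤ t≤ scat dist hubs
        with ram₂ (λ x y → Walk E (vs ++ S) r (col x) (col y)) xs N≤
      ... | ys , σ , l , inj₂ none =
        vs , ys , m≤m+n _ _ , σ , ≤-trans (m≤m+n m _) l , AllSub-map₂ ys extend (AllSub-zip₂ ys (AllSub-⊆ 2 σ scat) none)
        where
        extend : ∀ {x y} → Far E S r (col x) (col y) × ¬ Walk E (vs ++ S) r (col x) (col y) →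
          Far E (vs ++ S) (suc r) (col x) (col y)
        extend (far , no-r) {k} k< w with m≤n⇒m<n∨m≡n (s≤s⁻¹ k<)
        ... | inj₁ k<r  = far k<r (weaken (∈-++⁺ʳ vs) w)
        ... | inj₂ refl = no-r w
      ... | ys , σ , l , inj₁ walks
        with ram₄ (λ k x y x' y' → path E (vs ++ S) r (col x) (col y) (toℕ k) ≡ path E (vs ++ S) r (col x') (col y') (toℕ k))
               ys (≤-trans (m≤n+m _ m) l)
      ... | zs , ρ , l' , homog with em {P = ∃[ k ] AllSub 4 (λ x y x' y' →
               path E (vs ++ S) r (col x) (col y) (toℕ {suc r} k) ≡ path E (vs ++ S) r (col x') (col y') (toℕ k)) zs}
      ... | no moving = ⊥-elim (noSystem sp _ (scatteredSystem (proj₁ sp) col default zs n₁ (≤-trans (m≤m+n n₁ _) l')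
              scat' (AllSub-⊆ 2 ρ walks) moves))
        where
        T = vs ++ S
        default : X
        default = first zs (≤-trans (≤-trans (m≤m+n 4 N') (m≤n+m _ n₁)) l')
          where
          first : ∀ zs → 4 ≤ length zs → X
          first (z ∷ _) _ = z
        scat' : Scattered E r T col zs
        scat' = Scattered-weaken zs (∈-++⁺ʳ vs) (AllSub-⊆ 2 (⊆-trans ρ σ) scat)
        moves : ∀ {k} → k ≤ r → AllSub 4 (λ x y x' y' → path E T r (col x) (col y) k ≢ path E T r (col x') (col y') k) zs
        moves k≤r with homog (fromℕ< (s≤s k≤r))
        ... | inj₁ eq = ⊥-elim (moving (_ , eq))
        ... | inj₂ ne = subst (λ k → AllSub 4 (λ x y x' y' → path E T r (col x) (col y) k ≢ path E T r (col x') (col y') k) zs)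
                          (toℕ-fromℕ< (s≤s k≤r)) ne
      ... | yes (k , same)
        with newHub (proj₁ sp) col zs (≤-trans (≤-trans (m≤m+n 4 N') (m≤n+m _ n₁)) l') (s≤s⁻¹ (toℕ<n k))
               (Scattered-weaken zs (∈-++⁺ʳ vs) (AllSub-⊆ 2 (⊆-trans ρ σ) scat))
               (AllSub-⊆ 2 ρ walks) same
      ... | v , as , v∉ , α , l'' , h+h≡r , hub
        with rec sp col S as (v ∷ vs)
               (+-cancelˡ-≤ 3 N' _ (≤-trans (≤-trans (n≤1+n _) (m≤n+m (4 + N') n₁)) (≤-trans l' l'')))
               (subst (t ≤_) (+-suc (length vs) τ) t≤)
               (AllSub-⊆ 2 as⊆ scat)
               -- The new hub lies on a path avoiding the old hubs, so it is none of them.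
               (AllSub₁-∈ vs (λ { y∈ refl → v∉ (∈-++⁺ˡ y∈) }) , dist)
               ((h+h≡r , AllSub-map₁ as (weaken (∈-++⁺ʳ vs)) hub) ,
                AllSub-map₁ vs (λ { (p , q) → p , AllSub-⊆ 1 as⊆ q }) hubs)
        where
        as⊆ : as ⊆ xs
        as⊆ = ⊆-trans α (⊆-trans ρ σ)
      ... | S' , bs , s≤ , β , m≤ , scat' =
        S' , bs , subst (length S' ≤_) (sym (+-suc (length vs) τ)) s≤ , ⊆-trans β (⊆-trans α (⊆-trans ρ σ)) , m≤ , scat'

  quasiWide : ∀ f → QuasiWide f
  quasiWide f zero = 0 , λ m → m , λ sp col xs m≤ → [] , xs , z≤n , ⊆-refl , m≤ , AllSub-zero xs
    where
    AllSub-zero : ∀ {V : Set} {E : V → V → Set} {X : Set} {col : X → V} xs → Scattered E 0 [] col xs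
    AllSub-zero []       = tt
    AllSub-zero (x ∷ xs) = AllSub₁-∈ xs (λ _ ()) , AllSub-zero xs
  quasiWide f (suc r) with quasiWide f r
  ... | s , wide = t + s , λ m → proj₁ (wide (proj₁ (refine m t))) , go m
    where
    -- The bound on hubs is the same for every m, so any value may be inserted here; this keeps `s`
    -- independent of m.
    t = ScatteringStep.t f r 0
    refine : ∀ m τ → ∃ (ScatteringStep.Refinement f r m τ)
    refine m = ScatteringStep.refine f r m
    go : ∀ m → Scattering f (suc r) (t + s) m (proj₁ (wide (proj₁ (refine m t))))
    go m sp col xs N≤ with proj₂ (wide (proj₁ (refine m t))) sp col xs N≤
    ... | S , ys , S≤ , σ , l , scat with proj₂ (refine m t) sp col S ys [] l ≤-refl scat tt tt
    ... | S' , zs , S'≤ , ρ , l' , scat' =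
      S' ++ S , zs , subst (_≤ t + s) (sym (length-++ S')) (+-mono-≤ S'≤ S≤) , ⊆-trans ρ σ , l' , scat'

-- Types and the swap game

allVecs : ∀ d n → List (Vec (Fin d) n)
allVecs d zero    = [] ∷ []
allVecs d (suc n) = cartesianProductWith _∷_ (allFin d) (allVecs d n)

∈-allVecs : ∀ {d n} (v : Vec (Fin d) n) → v ∈ allVecs d n
∈-allVecs []      = here refl
∈-allVecs (x ∷ v) = ∈-cartesianProductWith⁺ _∷_ (∈-allFin x) (∈-allVecs v)

module _ {σ : Signature} where

  atoms : ∀ d → List (Formula σ d)
  atoms d = concatMap (λ R → map (atom R) (allVecs d (arity σ R))) (allFin (nsym σ)) ++
            cartesianProductWith _≐_ (allFin d) (allFin d)

  -- The members are complete conjunctions, containing each given formula or its negation, with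
  -- `fz ≐ fz` as the empty conjunction.
  literals : ∀ {d} → List (Formula σ (suc d)) → List (Formula σ (suc d))
  literals []       = (fz ≐ fz) ∷ []
  literals (φ ∷ φs) = map (φ ∧'_) (literals φs) ++ map ((~ φ) ∧'_) (literals φs)

  -- A finite list of formulas of quantifier rank ≤ k deciding the k-round back-and-forth type.
  typeFormulas : ℕ → ∀ d → List (Formula σ d)
  typeFormulas zero    d = atoms d
  typeFormulas (suc k) d = typeFormulas k d ++ map ∃' (literals (typeFormulas k (suc d)))

  rank : ∀ {d} → Formula σ d → ℕ
  rank (atom R x) = 0
  rank (x ≐ y)    = 0
  rank (~ φ)      = rank φ
  rank (φ ∧' ψ)   = rank φ ⊔ rank ψ
  rank (φ ∨' ψ)   = rank φ ⊔ rank ψ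
  rank (∃' φ)     = suc (rank φ)
  rank (∀' φ)     = suc (rank φ)

GaifEdge-sym : ∀ {σ} (M : Structure σ) {x y} → GaifEdge M x y → GaifEdge M y x
GaifEdge-sym M (x≢y , R , t , r , p , q) = x≢y ∘ sym , R , t , r , q , p

-- Two distinct entries exhaust a tuple of length at most 2, so all of it is named by indices.
pairTuple : ∀ {V : Set} {d n} → n ≤ 2 → (u : Fin d → V) {i j : Fin d} (t : Vec V n) →
  u i ∈ᵛ t → u j ∈ᵛ t → u i ≢ u j → Σ[ js ∈ Vec (Fin d) n ] (mapᵛ u js ≡ t × i ∈ᵛ js × j ∈ᵛ js)
pairTuple _ u (x ∷ t)     (VAny.here refl) (VAny.here q) ne = ⊥-elim (ne (sym q))
pairTuple _ u {i} {j} (x ∷ y ∷ []) (VAny.here refl) (VAny.there (VAny.here refl)) ne =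
  i ∷ j ∷ [] , refl , VAny.here refl , VAny.there (VAny.here refl)
pairTuple _ u {i} {j} (x ∷ y ∷ []) (VAny.there (VAny.here refl)) (VAny.here refl) ne =
  j ∷ i ∷ [] , refl , VAny.there (VAny.here refl) , VAny.here refl
pairTuple _ u (x ∷ y ∷ []) (VAny.there (VAny.here refl)) (VAny.there (VAny.here q)) ne = ⊥-elim (ne (sym q))
pairTuple (s≤s (s≤s ())) u (x ∷ y ∷ z ∷ t) _ _ _

module Types (em : ExcludedMiddle 0ℓ) {σ : Signature} (M : Structure σ) where
  private V = Car M

  Agree : ∀ {d} → (Fin d → V) → (Fin d → V) → Formula σ d → Set
  Agree u u' φ = (Sat M φ u → Sat M φ u') × (Sat M φ u' → Sat M φ u)

  SameType : ℕ → ∀ {d} → (Fin d → V) → (Fin d → V) → Set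
  SameType k {d} u u' = ∀ {φ} → φ ∈ typeFormulas k d → Agree u u' φ

  SameType-sym : ∀ k {d} {u u' : Fin d → V} → SameType k u u' → SameType k u' u
  SameType-sym k s φ∈ = swap (s φ∈)

  SameType-pred : ∀ k {d} {u u' : Fin d → V} → SameType (suc k) u u' → SameType k u u'
  SameType-pred k s φ∈ = s (∈-++⁺ˡ φ∈)

  literals-complete : ∀ {d} φs (u : Fin (suc d) → V) → ∃[ ψ ] (ψ ∈ literals φs × Sat M ψ u)
  literals-complete []       u = _ , here refl , refl
  literals-complete (φ ∷ φs) u with literals-complete φs u | em {P = Sat M φ u}
  ... | ψ , ψ∈ , s | yes p = _ , ∈-++⁺ˡ (∈-map⁺ (φ ∧'_) ψ∈) , p , s
  ... | ψ , ψ∈ , s | no ¬p = _ , ∈-++⁺ʳ _ (∈-map⁺ ((~ φ) ∧'_) ψ∈) , ¬p , s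

  literals-agree : ∀ {d} φs {u u' : Fin (suc d) → V} {ψ} → ψ ∈ literals φs → Sat M ψ u → Sat M ψ u' →
    ∀ {φ} → φ ∈ φs → Agree u u' φ
  literals-agree (φ ∷ φs) ψ∈ s s' φ∈ with ∈-++⁻ (map (φ ∧'_) (literals φs)) ψ∈
  literals-agree (φ ∷ φs) ψ∈ s s' φ∈ | inj₁ ψ∈' with ∈-map⁻ (φ ∧'_) ψ∈'
  literals-agree (φ ∷ φs) ψ∈ (p , s) (p' , s') (here refl) | inj₁ ψ∈' | χ , χ∈ , refl = (λ _ → p') , (λ _ → p)
  literals-agree (φ ∷ φs) ψ∈ (p , s) (p' , s') (there φ∈)  | inj₁ ψ∈' | χ , χ∈ , refl = literals-agree φs χ∈ s s' φ∈
  literals-agree (φ ∷ φs) ψ∈ s s' φ∈ | inj₂ ψ∈' with ∈-map⁻ ((~ φ) ∧'_) ψ∈'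
  literals-agree (φ ∷ φs) ψ∈ (p , s) (p' , s') (here refl) | inj₂ ψ∈' | χ , χ∈ , refl = (λ q → ⊥-elim (p q)) , (λ q → ⊥-elim (p' q))
  literals-agree (φ ∷ φs) ψ∈ (p , s) (p' , s') (there φ∈)  | inj₂ ψ∈' | χ , χ∈ , refl = literals-agree φs χ∈ s s' φ∈

  -- The complete conjunction true of e over u is, quantified existentially, among the formulas of
  -- the next level; a witness over u' satisfies the same conjunction.
  SameType-forth : ∀ k {d} {u u' : Fin d → V} → SameType (suc k) u u' →
    ∀ e → ∃[ e' ] SameType k (e VF.∷ u) (e' VF.∷ u')
  SameType-forth k {d} {u} s e with literals-complete (typeFormulas k (suc d)) (e VF.∷ u)
  ... | ψ , ψ∈ , sat with proj₁ (s (∈-++⁺ʳ (typeFormulas k d) (∈-map⁺ ∃' ψ∈))) (e , sat)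
  ... | e' , sat' = e' , literals-agree (typeFormulas k (suc d)) ψ∈ sat sat'

  atoms⊆ : ∀ k {d} {φ : Formula σ d} → φ ∈ atoms d → φ ∈ typeFormulas k d
  atoms⊆ zero    φ∈ = φ∈
  atoms⊆ (suc k) φ∈ = ∈-++⁺ˡ (atoms⊆ k φ∈)

  SameType-rel : ∀ k {d} {u u' : Fin d → V} → SameType k u u' →
    ∀ R js → rel M R (mapᵛ u js) → rel M R (mapᵛ u' js)
  SameType-rel k s R js = proj₁ (s (atoms⊆ k (∈-++⁺ˡ
    (∈-concatMap⁺ (λ R → map (atom R) (allVecs _ (arity σ R))) (∈⇒Any (∈-map⁺ (atom R) (∈-allVecs js)) (∈-allFin R))))))
    where
    ∈⇒Any : ∀ {A : Set} {P : A → Set} {x xs} → P x → x ∈ xs → Any P xs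
    ∈⇒Any p = Any.map λ { refl → p }

  SameType-≡ : ∀ k {d} {u u' : Fin d → V} → SameType k u u' → ∀ {i j} → u i ≡ u j → u' i ≡ u' j
  SameType-≡ k s {i} {j} = proj₁ (s (atoms⊆ k (∈-++⁺ʳ _ (∈-cartesianProductWith⁺ _≐_ (∈-allFin i) (∈-allFin j)))))

  SameType-edge : ∀ k {d} {u u' : Fin d → V} → SameType k u u' → ∀ {i j} →
    GaifEdge M (u i) (u j) → GaifEdge M (u' i) (u' j)
  SameType-edge k {u = u} {u'} s (ne , R , t , r , p , q) with pairTuple (arity≤2 σ R) u t p q ne
  ... | js , refl , p' , q' = (ne ∘ SameType-≡ k (SameType-sym k s)) , R , _ , SameType-rel k s R js r , ∈ᵛ-map⁺ u' p' , ∈ᵛ-map⁺ u' q'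

  SameType-∉ : ∀ k {d} {u u' : Fin d → V} {S} (sx : Fin (length S) → Fin d) →
    (∀ x → u (sx x) ≡ lookup S x) → (∀ x → u' (sx x) ≡ lookup S x) →
    SameType k u u' → ∀ {i} → u i ∉ S → u' i ∉ S
  SameType-∉ k {S = S} sx us us' s u∉ u'∈ = u∉ (subst (_∈ S) (sym (trans
    (SameType-≡ k (SameType-sym k s) (trans (lookup-index u'∈) (sym (us' (index u'∈))))) (us (index u'∈))))
    (∈-lookup (index u'∈)))

  -- Each step costs one round of back-and-forth. S is named by the pebbles `sx`, so that avoiding
  -- it is decided by equality atoms.
  SameType-walk : ∀ k {d} {u u' : Fin d → V} {S} (sx : Fin (length S) → Fin d) →
    (∀ x → u (sx x) ≡ lookup S x) → (∀ x → u' (sx x) ≡ lookup S x) →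
    SameType k u u' → ∀ {n i j a b} → n ≤ k → a ≡ u i → b ≡ u j →
    Walk (GaifEdge M) S n a b → Walk (GaifEdge M) S n (u' i) (u' j)
  SameType-walk k {u' = u'} {S} sx us us' s {i = i} n≤k refl b≡ (stop u∉) =
    subst (Walk (GaifEdge M) S 0 (u' i)) (SameType-≡ k s b≡) (stop (SameType-∉ k sx us us' s u∉))
  SameType-walk (suc k) sx us us' s {i = i} {j} (s≤s n≤k) refl b≡ (step {b = e} u∉ edge w) with SameType-forth k s e
  ... | e' , s' = step (SameType-∉ (suc k) sx us us' s u∉) (SameType-edge k s' {fs i} {fz} edge)
                    (SameType-walk k (fs ∘ sx) us us' s' {i = fz} {fs j} n≤k refl b≡ w)

-- The swap game: pebbles near c on one board answer pebbles near c' on the other, and all remaining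
-- pebbles are answered by themselves.  The near pebbles stay within distance L of c, c' and the others
-- beyond distance F, where with k rounds to go F exceeds L by at least 2 ^ k.
module Swap (em : ExcludedMiddle 0ℓ) {σ : Signature} (M : Structure σ) (S : List (Car M)) {d : ℕ} (radius : ℕ) where
  open Types em M
  private
    V = Car M
    E = GaifEdge M

  Near : ℕ → (Fin d → V) → V → Set
  Near L c x = ∃[ i ] ∃[ n ] (n ≤ L × Walk E S n (c i) x)

  Near-mono : ∀ {L L' c x} → L ≤ L' → Near L c x → Near L' c x
  Near-mono L≤ (i , n , n≤ , w) = i , n , ≤-trans n≤ L≤ , w

  Near-edge : ∀ {L c x y} → y ∉ S → E x y → Near L c x → Near (suc L) c y
  Near-edge y∉ e (i , n , n≤ , w) =
    i , n + 1 , subst (n + 1 ≤_) (+-comm _ 1) (+-monoˡ-≤ 1 n≤) , (w ⊕ step (end∉ w) e (stop y∉))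

  -- Elements of S answer themselves, so the types compared are types over S; the pebbles on c and
  -- c' let `near` carry distances across.
  record Board (k : ℕ) (c c' : Fin d → V) : Set where
    field
      {size}   : ℕ
      u u'     : Fin size → V
      same     : SameType k u u'
      inS      : Fin (length S) → Fin size
      u-inS    : ∀ x → u (inS x) ≡ lookup S x
      u'-inS   : ∀ x → u' (inS x) ≡ lookup S x
      inC      : Fin d → Fin size
      u-inC    : ∀ i → u (inC i) ≡ c i
      u'-inC   : ∀ i → u' (inC i) ≡ c' i

    near : ∀ {L j} → L ≤ k → Near L c (u j) → Near L c' (u' j)
    near {L} {j} L≤k (i , n , n≤ , w) = i , n , n≤ ,
      subst (λ z → Walk E S n z (u' j)) (u'-inC i)
        (SameType-walk k inS u-inS u'-inS same (≤-trans n≤ L≤k) (sym (u-inC i)) refl w)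

  flip : ∀ {k c c'} → Board k c c' → Board k c' c
  flip {k} B = record
    { u = u' ; u' = u ; same = SameType-sym k same ; inS = inS ; u-inS = u'-inS ; u'-inS = u-inS
    ; inC = inC ; u-inC = u'-inC ; u'-inC = u-inC }
    where open Board B

  lower : ∀ {k c c'} → Board (suc k) c c' → Board k c c'
  lower {k} B = record
    { u = u ; u' = u' ; same = SameType-pred k same ; inS = inS ; u-inS = u-inS ; u'-inS = u'-inS
    ; inC = inC ; u-inC = u-inC ; u'-inC = u'-inC }
    where open Board B

  play : ∀ {k c c'} (B : Board (suc k) c c') (e e' : V) →
    SameType k (e VF.∷ Board.u B) (e' VF.∷ Board.u' B) → Board k c c'
  play B e e' s = record
    { u = e VF.∷ u ; u' = e' VF.∷ u' ; same = s ; inS = fs ∘ inS ; u-inS = u-inS ; u'-inS = u'-inS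
    ; inC = fs ∘ inC ; u-inC = u-inC ; u'-inC = u'-inC }
    where open Board B

  module _ {c c' : Fin d → V} (apart : ∀ i j → Far E S (2 + (radius + radius)) (c i) (c' j)) where

    -- Two boards, because pebbles near c go to c' while pebbles near c' go to c. Elements of S fall
    -- under `fixed`, being near nothing.
    data Kind {k} (A : Board k c c') (B : Board k c' c) (L F : ℕ) (x x' : V) : Set where
      onA   : ∀ j → Board.u A j ≡ x → Board.u' A j ≡ x' → Near L c x → Near L c' x' → Kind A B L F x x'
      onB   : ∀ j → Board.u B j ≡ x → Board.u' B j ≡ x' → Near L c' x → Near L c x' → Kind A B L F x x'
      fixed : x ≡ x' → ¬ Near F c x → ¬ Near F c' x → Kind A B L F x x'

    -- Besides the k rounds to be played, the boards keep `radius` rounds in reserve for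
    -- transporting walks of that length.
    record Position (k : ℕ) {m} (ρ ρ' : Fin m → V) : Set where
      field
        {L F}  : ℕ
        A      : Board (k + radius) c c'
        B      : Board (k + radius) c' c
        gap    : L + 2 ^ k ≤ F
        bound  : F ≤ radius
        kind   : ∀ i → Kind A B L F (ρ i) (ρ' i)

    Position-sym : ∀ {k m} {ρ ρ' : Fin m → V} → Position k ρ ρ' → Position k ρ' ρ
    Position-sym {k} {m} {ρ} {ρ'} P = record { A = flip B ; B = flip A ; gap = gap ; bound = bound ; kind = λ i → swapKind (kind i) }
      where
      open Position P
      swapKind : ∀ {x x'} → Kind A B L F x x' → Kind (flip B) (flip A) L F x' x
      swapKind (onA j p q n n')   = onB j q p n' n
      swapKind (onB j p q n n')   = onA j q p n' n
      swapKind (fixed refl n n')  = fixed refl n n'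

    forth : ∀ {k m} {ρ ρ' : Fin m → V} → Position (suc k) ρ ρ' → ∀ e →
      ∃[ e' ] Position k (e VF.∷ ρ) (e' VF.∷ ρ')
    forth {k} {m} {ρ} {ρ'} P e = respond
      where
      open Position P
      -- From L + 2 ^ suc k ≤ F, both L to `mid` and `mid` to F are gaps of at least 2 ^ k: a move
      -- within `mid` raises L to it, any other move lowers F to it.
      mid : ℕ
      mid = L + 2 ^ k
      mid+≤F : mid + 2 ^ k ≤ F
      mid+≤F = subst (_≤ F) (sym (trans (+-assoc L (2 ^ k) (2 ^ k)) (cong (λ z → L + (2 ^ k + z)) (sym (+-identityʳ _))))) gap
      mid≤F : mid ≤ F
      mid≤F = ≤-trans (m≤m+n mid _) mid+≤F
      mid≤ : mid ≤ k + radius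
      mid≤ = ≤-trans mid≤F (≤-trans bound (m≤n+m radius k))
      L≤mid : L ≤ mid
      L≤mid = m≤m+n L _
      respond : ∃[ e' ] Position k (e VF.∷ ρ) (e' VF.∷ ρ')
      respond with em {P = Near mid c e} | em {P = Near mid c' e}
      ... | yes n | _ with SameType-forth (k + radius) (Board.same A) e
      ... | e' , s = e' , record { A = play A e e' s ; B = lower B ; gap = mid+≤F ; bound = bound ; kind = kind' }
        where
        old : ∀ {x x'} → Kind A B L F x x' → Kind (play A e e' s) (lower B) mid F x x'
        old (onA j p q n n')  = onA (fs j) p q (Near-mono L≤mid n) (Near-mono L≤mid n')
        old (onB j p q n n')  = onB j p q (Near-mono L≤mid n) (Near-mono L≤mid n')
        old (fixed p n n')    = fixed p n n'
        kind' : ∀ i → Kind (play A e e' s) (lower B) mid F ((e VF.∷ ρ) i) ((e' VF.∷ ρ') i)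
        kind' fz     = onA fz refl refl n (Board.near (play A e e' s) {j = fz} mid≤ n)
        kind' (fs i) = old (kind i)
      respond | no _ | yes n with SameType-forth (k + radius) (Board.same B) e
      ... | e' , s = e' , record { A = lower A ; B = play B e e' s ; gap = mid+≤F ; bound = bound ; kind = kind' }
        where
        old : ∀ {x x'} → Kind A B L F x x' → Kind (lower A) (play B e e' s) mid F x x'
        old (onA j p q n n')  = onA j p q (Near-mono L≤mid n) (Near-mono L≤mid n')
        old (onB j p q n n')  = onB (fs j) p q (Near-mono L≤mid n) (Near-mono L≤mid n')
        old (fixed p n n')    = fixed p n n'
        kind' : ∀ i → Kind (lower A) (play B e e' s) mid F ((e VF.∷ ρ) i) ((e' VF.∷ ρ') i)
        kind' fz     = onB fz refl refl n (Board.near (play B e e' s) {j = fz} mid≤ n)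
        kind' (fs i) = old (kind i)
      respond | no ¬n | no ¬n' = e , record { A = lower A ; B = lower B ; gap = ≤-refl ; bound = ≤-trans mid≤F bound ; kind = kind' }
        where
        old : ∀ {x x'} → Kind A B L F x x' → Kind (lower A) (lower B) L mid x x'
        old (onA j p q n n')  = onA j p q n n'
        old (onB j p q n n')  = onB j p q n n'
        old (fixed p n n')    = fixed p (n ∘ Near-mono mid≤F) (n' ∘ Near-mono mid≤F)
        kind' : ∀ i → Kind (lower A) (lower B) L mid ((e VF.∷ ρ) i) ((e VF.∷ ρ') i)
        kind' fz     = fixed refl ¬n ¬n'
        kind' (fs i) = old (kind i)

    -- The reasons why an atom on x, y passes to x', y'. `unrelated` looks at x, y alone, since
    -- transfer is one-way and its converse comes from `Position-sym`.
    data Compatible (k : ℕ) (x x' y y' : V) : Set where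
      matched   : ∀ {s} {u u' : Fin s → V} → SameType k u u' →
                  ∀ i j → u i ≡ x → u' i ≡ x' → u j ≡ y → u' j ≡ y' → Compatible k x x' y y'
      unmoved   : x ≡ x' → y ≡ y' → Compatible k x x' y y'
      unrelated : x ≢ y → ¬ E x y → Compatible k x x' y y'

    Compatible-sym : ∀ {k x x' y y'} → Compatible k x x' y y' → Compatible k y y' x x'
    Compatible-sym (matched s i j p q p' q') = matched s j i p' q' p q
    Compatible-sym (unmoved p q)             = unmoved q p
    Compatible-sym (unrelated p q)           = unrelated (p ∘ sym) (q ∘ GaifEdge-sym M)

    -- Equality would give a walk of length at most 2 · radius between c and c', and an edge one
    -- more; hence the 2 in `apart`.
    near-apart : ∀ {L x y} → L ≤ radius → Near L c x → Near L c' y → x ≢ y × ¬ E x y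
    near-apart {L} L≤ (i , n , n≤ , w) (j , n' , n'≤ , w') =
      (λ { refl → apart i j (s≤s (m≤n⇒m≤1+n (+-mono-≤ (≤-trans n≤ L≤) (≤-trans n'≤ L≤)))) (w ⊕ reverse (GaifEdge-sym M) w') }) ,
      (λ e → apart i j (s≤s (subst (_≤ suc (radius + radius)) (sym (+-suc n n')) (s≤s (+-mono-≤ (≤-trans n≤ L≤) (≤-trans n'≤ L≤)))))
        (w ⊕ step (end∉ w) e (reverse (GaifEdge-sym M) w')))

    -- An element of S may be adjacent to near pebbles, but is itself named on the board. Any other
    -- neighbour of x is within L + 1 ≤ F and could not be fixed.
    near-fixed : ∀ {k a a' L F x x' y y'} (A : Board k a a') → L < F →
      ∀ j → Board.u A j ≡ x → Board.u' A j ≡ x' → Near L a x → y ≡ y' → ¬ Near F a y → Compatible k x x' y y'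
    near-fixed {y = y} A L<F j p q n refl far with em {P = y ∈ S}
    ... | yes y∈ = matched (Board.same A) j (inS (index y∈)) p q
                     (trans (u-inS _) (sym (lookup-index y∈))) (trans (u'-inS _) (sym (lookup-index y∈)))
      where open Board A
    ... | no y∉  = unrelated (λ { refl → far (Near-mono (<⇒≤ L<F) n) }) (λ e → far (Near-mono L<F (Near-edge y∉ e n)))

    compatible : ∀ {k L F} {A : Board k c c'} {B : Board k c' c} → L < F → F ≤ radius → ∀ {x x' y y'} →
      Kind A B L F x x' → Kind A B L F y y' → Compatible k x x' y y'
    compatible {A = A} {B} L<F F≤ = go
      where
      L≤ = ≤-trans (<⇒≤ L<F) F≤
      go : ∀ {x x' y y'} → Kind A B _ _ x x' → Kind A B _ _ y y' → Compatible _ x x' y y'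
      go (onA i p q n _) (onA j p' q' n' _) = matched (Board.same A) i j p q p' q'
      go (onA i p q n _) (onB j p' q' n' _) = let ne , ¬e = near-apart L≤ n n' in unrelated ne ¬e
      go (onA i p q n _) (fixed e f _)      = near-fixed A L<F i p q n e f
      go (onB i p q n _) (onA j p' q' n' _) = let ne , ¬e = near-apart L≤ n' n in Compatible-sym (unrelated ne ¬e)
      go (onB i p q n _) (onB j p' q' n' _) = matched (Board.same B) i j p q p' q'
      go (onB i p q n _) (fixed e _ f)      = near-fixed B L<F i p q n e f
      go (fixed e f _)   (onA j p q n _)    = Compatible-sym (near-fixed A L<F j p q n e f)
      go (fixed e _ f)   (onB j p q n _)    = Compatible-sym (near-fixed B L<F j p q n e f)
      go (fixed e _ _)   (fixed e' _ _)     = unmoved e e'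

    -- Abstracting the relation to `Q` turns its arity into a variable that can be matched on. A
    -- unary atom uses compatibility of an index with itself.
    transfer-rel : ∀ {k m n} {ρ ρ' : Fin m → V} → (∀ i j → Compatible k (ρ i) (ρ' i) (ρ j) (ρ' j)) →
      n ≤ 2 → (Q : Vec V n → Set) →
      (∀ t {x y} → Q t → x ∈ᵛ t → y ∈ᵛ t → x ≢ y → E x y) →
      (∀ {s} {u u' : Fin s → V} → SameType k u u' → ∀ js → Q (mapᵛ u js) → Q (mapᵛ u' js)) →
      ∀ ts → Q (mapᵛ ρ ts) → Q (mapᵛ ρ' ts)
    transfer-rel comp _ Q edge pres [] r = r
    transfer-rel comp _ Q edge pres (i ∷ []) r with comp i i
    ... | matched s a b p q _ _ = subst (λ z → Q (z ∷ [])) q (pres s (a ∷ []) (subst (λ z → Q (z ∷ [])) (sym p) r))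
    ... | unmoved p _           = subst (λ z → Q (z ∷ [])) p r
    ... | unrelated ne _        = ⊥-elim (ne refl)
    transfer-rel {ρ = ρ} comp _ Q edge pres (i ∷ j ∷ []) r with comp i j
    ... | matched s a b p q p' q' = subst₂ (λ z w → Q (z ∷ w ∷ [])) q q'
                                      (pres s (a ∷ b ∷ []) (subst₂ (λ z w → Q (z ∷ w ∷ [])) (sym p) (sym p') r))
    ... | unmoved p q             = subst₂ (λ z w → Q (z ∷ w ∷ [])) p q r
    ... | unrelated ne ¬e         = ⊥-elim (¬e (edge _ r (VAny.here refl) (VAny.there (VAny.here refl)) ne))
    transfer-rel comp (s≤s (s≤s ())) Q edge pres (_ ∷ _ ∷ _ ∷ _)

    position-compatible : ∀ {k m} {ρ ρ' : Fin m → V} → Position k ρ ρ' →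
      ∀ i j → Compatible (k + radius) (ρ i) (ρ' i) (ρ j) (ρ' j)
    position-compatible {k} P i j = compatible (<-≤-trans (m<m+n L (m^n>0 2 k)) gap) bound (kind i) (kind j)
      where open Position P

    transfer : ∀ {m} (φ : Formula σ m) {k} {ρ ρ' : Fin m → V} → rank φ ≤ k → Position k ρ ρ' →
      Sat M φ ρ → Sat M φ ρ'
    transfer (atom R ts) {k} _ P s = transfer-rel (position-compatible P) (arity≤2 σ R) (rel M R)
      (λ t r p q ne → ne , R , t , r , p , q) (λ s → SameType-rel (k + radius) s R) ts s
    transfer (i ≐ j) {k} _ P e with position-compatible P i j
    ... | matched s a b p q p' q' = trans (sym q) (trans (SameType-≡ (k + radius) s (trans p (trans e (sym p')))) q')
    ... | unmoved p q             = trans (sym p) (trans e q)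
    ... | unrelated ne _          = ⊥-elim (ne e)
    transfer (~ φ)    le P s s' = s (transfer φ le (Position-sym P) s')
    transfer (φ ∧' ψ) le P (s , s') = transfer φ (m⊔n≤o⇒m≤o _ _ le) P s , transfer ψ (m⊔n≤o⇒n≤o (rank φ) _ le) P s'
    transfer (φ ∨' ψ) le P (inj₁ s) = inj₁ (transfer φ (m⊔n≤o⇒m≤o _ _ le) P s)
    transfer (φ ∨' ψ) le P (inj₂ s) = inj₂ (transfer ψ (m⊔n≤o⇒n≤o (rank φ) _ le) P s)
    transfer (∃' φ) {suc k} (s≤s le) P (e , s) with forth P e
    ... | e' , P' = e' , transfer φ le P' s
    transfer (∀' φ) {suc k} (s≤s le) P s e' with forth (Position-sym P) e'
    ... | e , P' = transfer φ le (Position-sym P') (s e)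

  initialBoard : ∀ {k} {c c' : Fin d → V} → SameType k (lookup S VF.++ c) (lookup S VF.++ c') → Board k c c'
  initialBoard {c = c} {c'} s = record
    { u = lookup S VF.++ c ; u' = lookup S VF.++ c' ; same = s
    ; inS = _↑ˡ d ; u-inS = lookup-++ˡ (lookup S) c ; u'-inS = lookup-++ˡ (lookup S) c'
    ; inC = length S ↑ʳ_ ; u-inC = lookup-++ʳ (lookup S) c ; u'-inC = lookup-++ʳ (lookup S) c' }

-- The game starts from a, b' against a', b: a is answered by a' on one board and b' by b on the
-- other. Near distance 0 and far distance 2 ^ rank φ give just the gap required for rank φ rounds.
swap-tuples : (em : ExcludedMiddle 0ℓ) → ∀ {σ} (M : Structure σ) (S : List (Car M)) p q (φ : Formula σ (p + q)) →
  ∀ (a a' : Fin p → Car M) (b b' : Fin q → Car M) →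
  (∀ i j → Far (GaifEdge M) S (2 + (2 ^ rank φ + 2 ^ rank φ)) ((a VF.++ b) i) ((a' VF.++ b') j)) →
  Types.SameType em M (rank φ + 2 ^ rank φ) (lookup S VF.++ (a VF.++ b)) (lookup S VF.++ (a' VF.++ b')) →
  Sat M φ (a VF.++ b') → Sat M φ (a' VF.++ b)
swap-tuples em {σ} M S p q φ a a' b b' apart s = transfer apart φ ≤-refl start
  where
  open Swap em M S {p + q} (2 ^ rank φ)
  open Types em M
  c  = a VF.++ b
  c' = a' VF.++ b'
  depth = rank φ + 2 ^ rank φ
  A : Board depth c c'
  A = initialBoard s
  B : Board depth c' c
  B = initialBoard (SameType-sym depth s)

  notNear : ∀ {L e x} → x ∈ S → ¬ Near L e x
  notNear x∈ (_ , _ , _ , w) = end∉ w x∈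

  near₀ : ∀ {e : Fin (p + q) → Car M} {i} → e i ∉ S → Near 0 e (e i)
  near₀ {i = i} e∉ = i , 0 , z≤n , stop e∉

  ∈⇒≡ : ∀ {k e e'} (D : Board k e e') {i} → e i ∈ S → e i ≡ e' i
  ∈⇒≡ {k} D {i} e∈ = trans (lookup-index e∈) (trans (sym (u'-inS _)) (trans
    (sym (SameType-≡ k same (trans (u-inC i) (trans (lookup-index e∈) (sym (u-inS _)))))) (u'-inC i)))
    where open Board D

  -- A coordinate of c in S equals that of c', as the types over S agree, and starts as a fixed
  -- pebble.
  startKind : ∀ {x x'} i → (x ≡ c i × x' ≡ c' i) ⊎ (x ≡ c' i × x' ≡ c i) → Kind apart A B 0 (2 ^ rank φ) x x'
  startKind i e with em {P = c i ∈ S} | em {P = c' i ∈ S} | e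
  ... | yes c∈ | _     | inj₁ (refl , refl) = fixed (∈⇒≡ A c∈) (notNear c∈) (notNear c∈)
  ... | yes c∈ | _     | inj₂ (refl , refl) = fixed (sym c≡) (notNear (subst (_∈ S) c≡ c∈)) (notNear (subst (_∈ S) c≡ c∈))
    where c≡ = ∈⇒≡ A c∈
  ... | no c∉ | yes c'∈ | _ = ⊥-elim (c∉ (subst (_∈ S) (∈⇒≡ B c'∈) c'∈))
  ... | no c∉ | no c'∉ | inj₁ (refl , refl) = onA (length S ↑ʳ i) (lookup-++ʳ (lookup S) c i) (lookup-++ʳ (lookup S) c' i) (near₀ c∉) (near₀ c'∉)
  ... | no c∉ | no c'∉ | inj₂ (refl , refl) = onB (length S ↑ʳ i) (lookup-++ʳ (lookup S) c' i) (lookup-++ʳ (lookup S) c i) (near₀ c'∉) (near₀ c∉)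

  sides : ∀ i → ((a VF.++ b') i ≡ c i × (a' VF.++ b) i ≡ c' i) ⊎ ((a VF.++ b') i ≡ c' i × (a' VF.++ b) i ≡ c i)
  sides i with splitAt p i
  ... | inj₁ _ = inj₁ (refl , refl)
  ... | inj₂ _ = inj₂ (refl , refl)

  start : Position apart (rank φ) (a VF.++ b') (a' VF.++ b)
  start = record { A = A ; B = B ; gap = ≤-refl ; bound = ≤-refl ; kind = λ i → startKind i (sides i) }

-- Bounds on ladders and on shallow clique minors

AllPairs⇒AllSub : ∀ {X : Set} {Q : X → X → Set} {xs} → AllPairs Q xs → AllSub 2 Q xs
AllPairs⇒AllSub []       = tt
AllPairs⇒AllSub (p ∷ ps) = All⇒AllSub p , AllPairs⇒AllSub ps
  where
  All⇒AllSub : ∀ {X : Set} {Q : X → Set} {xs} → All Q xs → AllSub 1 Q xs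
  All⇒AllSub []       = tt
  All⇒AllSub (p ∷ ps) = p , All⇒AllSub ps

allFin-increasing : ∀ n → AllSub 2 _<ᶠ_ (allFin n)
allFin-increasing n = AllPairs⇒AllSub {Q = _<ᶠ_ {n} {n}} (tabulate⁺-< {f = id} id)

length-allFin : ∀ n → length (allFin n) ≡ n
length-allFin n = length-tabulate id

-- Pigeonhole: too few representatives are available for pairwise disjoint sets.
systemOfRepresentatives : ∀ {X Y : Set} (S : List Y) (xs : List X) → length S < length xs → (Q : X → Y → Set) →
  AllSub 1 (λ x → ∃[ y ] (y ∈ S × Q x y)) xs → ¬ AllSub 2 (λ x x' → ∀ y → Q x y → ¬ Q x' y) xs
systemOfRepresentatives S (x₀ ∷ xs) lt Q represented disjoint with pigeonhole lt (λ i → index (proj₁ (proj₂ (rep i))))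
  where
  rep : ∀ i → ∃[ y ] (y ∈ S × Q (nth x₀ (x₀ ∷ xs) (toℕ i)) y)
  rep i = nth₁ x₀ (x₀ ∷ xs) represented (toℕ<n i)
... | i , j , i<j , same with nth₁ x₀ (x₀ ∷ xs) represented (toℕ<n i) | nth₁ x₀ (x₀ ∷ xs) represented (toℕ<n j)
... | y , y∈ , q | y' , y'∈ , q' =
  nth₂ x₀ (x₀ ∷ xs) disjoint i<j (toℕ<n j) y q
    (subst (Q _) (trans (lookup-index y'∈) (trans (cong (lookup S) (sym same)) (sym (lookup-index y∈)))) q')

module Bounds (em : ExcludedMiddle 0ℓ) where
  open Ramsey em
  open SparsePaths em
  open QuasiWideness em

  coordinatewise : ∀ f r d → ∃[ s ] ∀ m → ∃[ N ] (∀ {V : Set} {E : V → V → Set} → Sparse f E →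
    ∀ {X : Set} (col : Fin d → X → V) xs → N ≤ length xs →
    ∃[ S ] ∃[ ys ] (length S ≤ s × ys ⊆ xs × m ≤ length ys × (∀ i → Scattered E r S (col i) ys)))
  coordinatewise f r zero = 0 , λ m → m , λ sp col xs le → [] , xs , z≤n , ⊆-refl , le , λ ()
  coordinatewise f r (suc d) with coordinatewise f r d | quasiWide f r
  ... | s₁ , wide₁ | s₂ , wide₂ = s₁ + s₂ , λ m → proj₁ (wide₁ (proj₁ (wide₂ m))) , go m
    where
    go : ∀ m {V : Set} {E : V → V → Set} → Sparse f E →
      ∀ {X : Set} (col : Fin (suc d) → X → V) xs → proj₁ (wide₁ (proj₁ (wide₂ m))) ≤ length xs →
      ∃[ S ] ∃[ ys ] (length S ≤ s₁ + s₂ × ys ⊆ xs × m ≤ length ys × (∀ i → Scattered E r S (col i) ys))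
    go m sp col xs le with proj₂ (wide₁ (proj₁ (wide₂ m))) sp (col ∘ fs) xs le
    ... | S₁ , ys , l₁ , τ , le' , scat₁ with proj₂ (wide₂ m) sp (col fz) ys le'
    ... | S₂ , zs , l₂ , ρ , le'' , scat₂ =
      S₁ ++ S₂ , zs , subst (_≤ s₁ + s₂) (sym (length-++ S₁)) (+-mono-≤ l₁ l₂) , ⊆-trans ρ τ , le'' ,
      λ { fz     → Scattered-weaken zs (∈-++⁺ʳ S₁) scat₂
        ; (fs i) → Scattered-weaken zs ∈-++⁺ˡ (AllSub-⊆ 2 ρ (scat₁ i)) }

  -- Each column is scattered at r + r first. Were column i always close to later entries of column
  -- j, then one entry of column i would be within r of two later entries of column j, contradicting
  -- their distance; this takes the three points added to m.
  quasiWideTuples : ∀ f r d → ∃[ s ] ∀ m → ∃[ N ] (∀ {V : Set} {E : V → V → Set} → Sparse f E →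
    ∀ {X : Set} (col : Fin d → X → V) xs → N ≤ length xs →
    ∃[ S ] ∃[ ys ] (length S ≤ s × ys ⊆ xs × m ≤ length ys × (∀ i j → AllSub 2 (λ x y → Far E S r (col i x) (col j y)) ys)))
  quasiWideTuples f r d with coordinatewise f (r + r) d
  ... | s , wide = s , λ m → proj₁ (wide (proj₁ (ram m))) , go m
    where
    ram : ∀ m → _
    ram m = ramseyFamily₂ 2 d d (m + 3)
    go : ∀ m {V : Set} {E : V → V → Set} → Sparse f E →
      ∀ {X : Set} (col : Fin d → X → V) xs → proj₁ (wide (proj₁ (ram m))) ≤ length xs →
      ∃[ S ] ∃[ ys ] (length S ≤ s × ys ⊆ xs × m ≤ length ys × (∀ i j → AllSub 2 (λ x y → Far E S r (col i x) (col j y)) ys))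
    go m {E = E} sp col xs le with proj₂ (wide (proj₁ (ram m))) sp col xs le
    ... | S , ys , l , τ , le' , scat with proj₂ (ram m) (λ i j x y → Far E S r (col i x) (col j y)) ys le'
    ... | zs , ρ , le'' , homog = S , zs , l , ⊆-trans ρ τ , ≤-trans (m≤m+n m 3) le'' , far
      where
      far : ∀ i j → AllSub 2 (λ x y → Far E S r (col i x) (col j y)) zs
      far i j with homog i j
      ... | inj₁ all  = all
      ... | inj₂ none = ⊥-elim (contra zs (≤-trans (m≤n+m 3 m) le'') none (AllSub-⊆ 2 ρ (scat j)))
        where
        close : ∀ {a b} → ¬ Far E S r a b → ∃[ n ] (n < r × Walk E S n a b)
        close {a} {b} ¬far with em {P = ∃[ n ] (n < r × Walk E S n a b)}
        ... | yes w = w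
        ... | no ¬w = ⊥-elim (¬far (λ l w → ¬w (_ , l , w)))
        contra : ∀ zs → 3 ≤ length zs → AllSub 2 (λ x y → ¬ Far E S r (col i x) (col j y)) zs →
          Scattered E (r + r) S (col j) zs → ⊥
        contra (x ∷ y ∷ z ∷ zs) (s≤s (s≤s (s≤s _))) ((xy , xz , _) , _) (_ , (yz , _) , _) =
          let n , n< , w = close xy
              n' , n'< , w' = close xz
          in yz (+-mono-< n< n'<) (join (proj₁ sp) w w')

  ladderBound : ∀ f {σ} p q (φ : Formula σ (p + q)) → ∃[ n ] (∀ (M : Structure σ) → Sparse f (GaifEdge M) →
    (a : Fin n → Fin p → Car M) (b : Fin n → Fin q → Car M) →
    ¬ (∀ i j → Sat M φ (a i VF.++ b j) ⇔ (i <ᶠ j)))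
  ladderBound f {σ} p q φ with quasiWideTuples f (2 + (2 ^ rank φ + 2 ^ rank φ)) (p + q)
  ... | s , wide = n , contra
    where
    formulas : ∀ l → List (Formula σ (l + (p + q)))
    formulas l = typeFormulas (rank φ + 2 ^ rank φ) (l + (p + q))
    types : ∀ l → _
    types l = ramseyFamily 1 (length (formulas l)) 2
    m n : ℕ
    -- Only an upper bound on the size of S is known, so m covers every size up to s.
    m = proj₁ (upperBound (proj₁ ∘ types) s)
    n = proj₁ (wide m)
    contra : (M : Structure σ) → Sparse f (GaifEdge M) →
      (a : Fin n → Fin p → Car M) (b : Fin n → Fin q → Car M) →
      ¬ (∀ i j → Sat M φ (a i VF.++ b j) ⇔ (i <ᶠ j))
    contra M sp a b order
      with proj₂ (wide m) sp (λ k i → (a i VF.++ b i) k) (allFin n) (≤-reflexive (sym (length-allFin n)))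
    ... | S , ys , S≤ , τ , m≤ , far
      with proj₂ (types (length S)) (λ e i → Sat M (lookup (formulas (length S)) e) (lookup S VF.++ (a i VF.++ b i))) ys
             (≤-trans (proj₂ (upperBound (proj₁ ∘ types) s) S≤) m≤)
    ... | [] , _ , () , _
    ... | _ ∷ [] , _ , s≤s () , _
    ... | i ∷ j ∷ _ , ρ , _ , homog = <ᶠ-asym i<j (Equivalence.to (order j i)
            (swap-tuples em M S p q φ (a i) (a j) (b i) (b j)
              (λ k l → proj₁ (proj₁ (AllSub-⊆ 2 ρ (far k l)))) same (Equivalence.from (order i j) i<j)))
      where
      i<j : i <ᶠ j
      i<j = proj₁ (proj₁ (AllSub-⊆ 2 (⊆-trans ρ τ) (allFin-increasing n)))
      same : Types.SameType em M (rank φ + 2 ^ rank φ) (lookup S VF.++ (a i VF.++ b i)) (lookup S VF.++ (a j VF.++ b j))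
      same {ψ} ψ∈ with homog (index ψ∈)
      ... | inj₁ (p , q , _) = subst (Types.Agree em M _ _) (sym (lookup-index ψ∈)) ((λ _ → q) , (λ _ → p))
      ... | inj₂ (p , q , _) = subst (Types.Agree em M _ _) (sym (lookup-index ψ∈)) ((λ r → ⊥-elim (p r)) , (λ r → ⊥-elim (q r)))

  minorWalk : ∀ {G U : Structure graphSig} {S} (h : Car U → Car G) → IsHom U G h → ∀ {P : Car U → Set} →
    (∀ {w} → P w → h w ∉ S) → ∀ r {x y} → P x → WalkIn U P r x y → ∃[ n ] (n ≤ r × Walk (Edge G) S n (h x) (h y))
  minorWalk h hom avoid zero    px refl        = 0 , z≤n , stop (avoid px)
  minorWalk h hom avoid (suc r) px (inj₁ refl) = 0 , z≤n , stop (avoid px)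
  minorWalk {G} {U} h hom avoid (suc r) px (inj₂ (z , e , pz , w)) with minorWalk {G} {U} h hom avoid r pz w
  ... | n , n≤ , w' = suc n , s≤s n≤ , step (avoid px) (hom fz _ e) w'

  -- At most |S| branch sets meet S, and the centres of two others are joined by a walk of length ≤ 2r + 1 avoiding S.
  minorBound : ∀ f r → ∃[ N ] (∀ m (G : Structure graphSig) → Sparse f (Edge G) → IsMinor r (K m) G → m ≤ N)
  minorBound f r with quasiWide f (2 + (r + r))
  ... | s , wide with ramsey 1 (2 + s)
  ... | N₁ , ram with wide N₁
  ... | N , scatter = N , λ m G sp minor → ≮⇒≥ (contra m G sp minor)
    where
    contra : ∀ m (G : Structure graphSig) → Sparse f (Edge G) → IsMinor r (K m) G → ¬ N < m
    contra m G sp (U , (U-sym , _) , (h , h-inj , hom) , π , _ , centre , adj) N<m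
      with scatter sp (λ x → h (proj₁ (centre x))) (allFin m) (subst (N ≤_) (sym (length-allFin m)) (<⇒≤ N<m))
    ... | S , ys , S≤ , τ , l , scat with ram (λ x → ∃[ u ] (π u ≡ x × h u ∈ S)) ys l
    ... | [] , _ , () , _
    ... | _ ∷ [] , _ , s≤s () , _
    ... | x ∷ y ∷ zs , ρ , l' , inj₂ (cleanx , cleany , _) = far (s≤s (walkLength n≤ n'≤)) (w ⊕ step (end∉ w) (hom fz _ edge) w'')
      where
      x<y : x <ᶠ y
      x<y = proj₁ (proj₁ (AllSub-⊆ 2 (⊆-trans ρ τ) (allFin-increasing m)))
      far : Far (Edge G) S (2 + (r + r)) (h (proj₁ (centre x))) (h (proj₁ (centre y)))
      far = proj₁ (proj₁ (AllSub-⊆ 2 ρ scat))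
      joined = proj₂ (Equivalence.to (adj x y) (<ᶠ⇒≢ x<y))
      u = proj₁ joined
      v = proj₁ (proj₂ joined)
      edge : Edge U u v
      edge = proj₂ (proj₂ (proj₂ (proj₂ joined)))
      toCentre : ∀ z {w} → π w ≡ z → ¬ (∃[ u ] (π u ≡ z × h u ∈ S)) →
        ∃[ n ] (n ≤ r × Walk (Edge G) S n (h (proj₁ (centre z))) (h w))
      toCentre z πw clean = minorWalk {G} {U} h hom (λ {w} πw w∈ → clean (w , πw , w∈)) r
        (proj₁ (proj₂ (centre z))) (proj₂ (proj₂ (centre z)) _ πw)
      walkx = toCentre x (proj₁ (proj₂ (proj₂ joined))) cleanx
      walky = toCentre y (proj₁ (proj₂ (proj₂ (proj₂ joined)))) cleany
      n≤ = proj₁ (proj₂ walkx)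
      n'≤ = proj₁ (proj₂ walky)
      w = proj₂ (proj₂ walkx)
      w'' = reverse (proj₁ sp) (proj₂ (proj₂ walky))
      walkLength : ∀ {n n'} → n ≤ r → n' ≤ r → n + suc n' ≤ suc (r + r)
      walkLength {n} {n'} p q = subst (_≤ suc (r + r)) (sym (+-suc n n')) (s≤s (+-mono-≤ p q))
    ... | xs , ρ , l' , inj₁ dirty = systemOfRepresentatives S xs (<-≤-trans (s≤s (m≤n⇒m≤1+n S≤)) l')
            (λ z v → ∃[ u ] (π u ≡ z × h u ≡ v))
            (AllSub-map₁ xs (λ { (u , p , u∈) → h u , u∈ , u , p , refl }) dirty)
            (AllSub-map₂ xs (λ { z<z' _ (u , refl , p) (u' , refl , p') → <ᶠ⇒≢ z<z' (cong π (h-inj (trans p (sym p')))) })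
              (AllSub-⊆ 2 (⊆-trans ρ τ) (allFin-increasing m)))

-- Coding bipartite graphs by subdivisions

module _ {σ : Signature} where

  false' : ∀ {k} → Fin k → Formula σ k
  false' x = ~ (x ≐ x)

  ⋁ : ∀ {k} → Fin k → ∀ n → (Fin n → Formula σ k) → Formula σ k
  ⋁ x zero    φ = false' x
  ⋁ x (suc n) φ = φ fz ∨' ⋁ x n (φ ∘ fs)

  onPair : ∀ {k} → Fin k → Fin k → ∀ n → (Vec (Fin k) n → Formula σ k) → Formula σ k
  onPair x y 0 φ = false' x
  onPair x y 1 φ = false' x
  onPair x y 2 φ = φ (x ∷ y ∷ []) ∨' φ (y ∷ x ∷ [])
  onPair x y (suc (suc (suc n))) φ = false' x

  adjacent : ∀ {k} → Fin k → Fin k → Formula σ k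
  adjacent x y = (~ (x ≐ y)) ∧' ⋁ x (nsym σ) (λ R → onPair x y (arity σ R) (atom R))

  walk : ∀ {k} → ℕ → Fin k → Fin k → Formula σ k
  walk zero    x y = x ≐ y
  walk (suc n) x y = ∃' (adjacent (fs x) fz ∧' walk n fz (fs y))

  module _ {M : Structure σ} where

    Sat-⋁⁻ : ∀ {k} {x : Fin k} n φ {ρ} → Sat M (⋁ x n φ) ρ → ∃[ i ] Sat M (φ i) ρ
    Sat-⋁⁻ zero    φ s        = ⊥-elim (s refl)
    Sat-⋁⁻ (suc n) φ (inj₁ s) = fz , s
    Sat-⋁⁻ (suc n) φ (inj₂ s) with Sat-⋁⁻ n (φ ∘ fs) s
    ... | i , s' = fs i , s'

    Sat-⋁⁺ : ∀ {k} {x : Fin k} n φ {ρ} i → Sat M (φ i) ρ → Sat M (⋁ x n φ) ρ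
    Sat-⋁⁺ (suc n) φ fz     s = inj₁ s
    Sat-⋁⁺ (suc n) φ (fs i) s = inj₂ (Sat-⋁⁺ n (φ ∘ fs) i s)

    Sat-onPair⁻ : ∀ {k} {x y : Fin k} n φ {ρ} → Sat M (onPair x y n φ) ρ →
      ∃[ js ] (Sat M (φ js) ρ × x ∈ᵛ js × y ∈ᵛ js)
    Sat-onPair⁻ 0 φ s = ⊥-elim (s refl)
    Sat-onPair⁻ 1 φ s = ⊥-elim (s refl)
    Sat-onPair⁻ 2 φ (inj₁ s) = _ , s , VAny.here refl , VAny.there (VAny.here refl)
    Sat-onPair⁻ 2 φ (inj₂ s) = _ , s , VAny.there (VAny.here refl) , VAny.here refl
    Sat-onPair⁻ (suc (suc (suc n))) φ s = ⊥-elim (s refl)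

    Sat-onPair⁺ : ∀ {k} {x y : Fin k} {n} → n ≤ 2 → ∀ φ {ρ} (t : Vec (Car M) n) → ρ x ≢ ρ y → ρ x ∈ᵛ t → ρ y ∈ᵛ t →
      (∀ js → mapᵛ ρ js ≡ t → Sat M (φ js) ρ) → Sat M (onPair x y n φ) ρ
    Sat-onPair⁺ _ φ (a ∷ t)      ne (VAny.here p) (VAny.here q) h = ⊥-elim (ne (trans p (sym q)))
    Sat-onPair⁺ _ φ (a ∷ b ∷ []) ne (VAny.here refl) (VAny.there (VAny.here refl)) h = inj₁ (h _ refl)
    Sat-onPair⁺ _ φ (a ∷ b ∷ []) ne (VAny.there (VAny.here refl)) (VAny.here refl) h = inj₂ (h _ refl)
    Sat-onPair⁺ _ φ (a ∷ b ∷ []) ne (VAny.there (VAny.here p)) (VAny.there (VAny.here q)) h = ⊥-elim (ne (trans p (sym q)))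
    Sat-onPair⁺ (s≤s (s≤s ())) φ (_ ∷ _ ∷ _ ∷ _) ne _ _ h

    Sat-adjacent⁻ : ∀ {k} {x y : Fin k} {ρ} → Sat M (adjacent x y) ρ → GaifEdge M (ρ x) (ρ y)
    Sat-adjacent⁻ {ρ = ρ} (ne , s) with Sat-⋁⁻ (nsym σ) _ s
    ... | R , s' with Sat-onPair⁻ (arity σ R) (atom R) s'
    ... | js , r , p , q = ne , R , _ , r , ∈ᵛ-map⁺ ρ p , ∈ᵛ-map⁺ ρ q

    Sat-adjacent⁺ : ∀ {k} {x y : Fin k} {ρ} → GaifEdge M (ρ x) (ρ y) → Sat M (adjacent x y) ρ
    Sat-adjacent⁺ {x = x} {y} {ρ} (ne , R , t , r , p , q) =
      ne , Sat-⋁⁺ (nsym σ) (λ R → onPair x y (arity σ R) (atom R)) R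
             (Sat-onPair⁺ (arity≤2 σ R) (atom R) {ρ} t ne p q λ _ e → subst (rel M R) (sym e) r)

    Sat-walk : ∀ {k} n {x y : Fin k} {ρ} → Sat M (walk n x y) ρ ⇔ Walk (GaifEdge M) [] n (ρ x) (ρ y)
    Sat-walk n = mk⇔ (to n) (λ w → from n w refl refl)
      where
      to : ∀ {k} n {x y : Fin k} {ρ} → Sat M (walk n x y) ρ → Walk (GaifEdge M) [] n (ρ x) (ρ y)
      to zero    {x} {ρ = ρ} s = subst (Walk (GaifEdge M) [] 0 (ρ x)) s (stop λ ())
      to (suc n) (e , adj , s) = step (λ ()) (Sat-adjacent⁻ {x = fs _} {fz} adj) (to n s)
      from : ∀ {k} n {x y : Fin k} {ρ a b} → Walk (GaifEdge M) [] n a b → a ≡ ρ x → b ≡ ρ y → Sat M (walk n x y) ρ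
      from zero    (stop _) p q = trans (sym p) q
      from (suc n) {x} {y} {ρ} (step {b = e} _ adj w) refl q =
        e , Sat-adjacent⁺ {x = fs x} {fz} {e VF.∷ ρ} adj , from n w refl q

module Subdivision (m r : ℕ) (W : Fin m → Fin m → Set) where

  Kept : SubdVert m r → SubdVert m r → Set
  Kept (inj₁ i)           (inj₁ j)           = W i j
  Kept (inj₁ _)           (inj₂ (i , j , _)) = W i j
  Kept (inj₂ (i , j , _)) _                  = W i j

  -- Removing the paths of pairs outside `W` leaves their inner vertices isolated, so the carrier is
  -- the same for all `W`.
  Sub : SubdVert m r → SubdVert m r → Set
  Sub x y = (SubdFwd m r x y × Kept x y) ⊎ (SubdFwd m r y x × Kept y x)

  Sub-edge : ∀ {x y} → Sub x y → SubdFwd m r x y ⊎ SubdFwd m r y x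
  Sub-edge (inj₁ (e , _)) = inj₁ e
  Sub-edge (inj₂ (e , _)) = inj₂ e

  module _ (a : Fin m) where

    -- A lower bound for the distance from branch vertex a: s steps may lead to x only if LB x s.
    LB : SubdVert m r → ℕ → Set
    LB (inj₁ b)               s = b ≡ a ⊎ ((W a b ⊎ W b a) × r < s) ⊎ suc r < s
    LB (inj₂ (i , j , _ , k)) s = (i ≡ a × toℕ k < s) ⊎ (j ≡ a × r ∸ toℕ k ≤ s) ⊎ suc r < s

    beyond : ∀ x {s} → suc r < s → LB x s
    beyond (inj₁ _) l = inj₂ (inj₂ l)
    beyond (inj₂ _) l = inj₂ (inj₂ l)

    LB-step : ∀ x y {s} → Sub x y → LB x s → LB y (suc s)
    LB-step (inj₁ b) (inj₁ c) (inj₁ ((refl , _) , w)) (inj₁ refl) = inj₂ (inj₁ (inj₁ w , s≤s z≤n))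
    LB-step (inj₁ b) (inj₁ c) (inj₂ ((refl , _) , w)) (inj₁ refl) = inj₂ (inj₁ (inj₂ w , s≤s z≤n))
    LB-step (inj₁ b) (inj₂ (i , j , _ , k)) (inj₁ ((refl , k≡0) , w)) (inj₁ refl) = inj₁ (refl , subst (_< suc _) (sym k≡0) (s≤s z≤n))
    LB-step (inj₁ b) (inj₂ (i , j , _ , k)) (inj₂ ((refl , k≡) , w)) (inj₁ refl) =
      inj₂ (inj₁ (refl , ≤-trans (≤-reflexive (trans (cong (_∸ toℕ k) (sym k≡)) (m+n∸n≡m 1 (toℕ k)))) (s≤s z≤n)))
    LB-step (inj₁ b) y _ (inj₂ (inj₁ (_ , r<s))) = beyond y (s≤s r<s)
    LB-step (inj₁ b) y _ (inj₂ (inj₂ r<s)) = beyond y (m≤n⇒m≤1+n r<s)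
    LB-step (inj₂ (i , j , _ , k)) (inj₁ b) (inj₁ ((refl , k≡) , w)) (inj₁ (refl , k<s)) =
      inj₂ (inj₁ (inj₁ w , s≤s (subst (_≤ _) k≡ k<s)))
    LB-step (inj₂ (i , j , _ , k)) (inj₁ b) (inj₁ ((refl , k≡) , w)) (inj₂ (inj₁ (refl , _))) = inj₁ refl
    LB-step (inj₂ (i , j , _ , k)) (inj₁ b) (inj₂ ((refl , k≡0) , w)) (inj₁ (refl , _)) = inj₁ refl
    LB-step (inj₂ (i , j , _ , k)) (inj₁ b) (inj₂ ((refl , k≡0) , w)) (inj₂ (inj₁ (refl , r≤))) =
      inj₂ (inj₁ (inj₂ w , s≤s (subst (λ z → r ∸ z ≤ _) k≡0 r≤)))
    LB-step (inj₂ (i , j , _ , k)) (inj₂ (_ , _ , _ , k')) (inj₁ ((refl , refl , k≡) , w)) (inj₁ (refl , k<s)) =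
      inj₁ (refl , subst (_< suc _) (sym k≡) (s≤s k<s))
    LB-step (inj₂ (i , j , _ , k)) (inj₂ (_ , _ , _ , k')) (inj₁ ((refl , refl , k≡) , w)) (inj₂ (inj₁ (refl , r≤))) =
      inj₂ (inj₁ (refl , ≤-trans (∸-monoʳ-≤ r (≤-trans (n≤1+n _) (≤-reflexive (sym k≡)))) (m≤n⇒m≤1+n r≤)))
    LB-step (inj₂ (i , j , _ , k)) (inj₂ (_ , _ , _ , k')) (inj₂ ((refl , refl , k≡) , w)) (inj₁ (refl , k<s)) =
      inj₁ (refl , ≤-trans (≤-reflexive (sym k≡)) (≤-trans (<⇒≤ k<s) (n≤1+n _)))
    LB-step (inj₂ (i , j , _ , k)) (inj₂ (_ , _ , _ , k')) (inj₂ ((refl , refl , k≡) , w)) (inj₂ (inj₁ (refl , r≤))) =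
      inj₂ (inj₁ (refl , ≤-trans (≤-reflexive (+-∸-assoc 1 (toℕ<n k'))) (s≤s (subst (λ z → r ∸ z ≤ _) k≡ r≤))))
    LB-step (inj₂ _) y _ (inj₂ (inj₂ r<s)) = beyond y (m≤n⇒m≤1+n r<s)

    LB-walk : ∀ {n x y s} → LB x s → Walk Sub [] n x y → LB y (n + s)
    LB-walk lb (stop _)     = lb
    LB-walk {suc n} {s = s} lb (step {a = x} {b = y} _ e w) = subst (LB _) (+-suc n s) (LB-walk (LB-step x y e lb) w)

  -- Within r + 1 steps of a, only kept paths at a can be traversed, so another branch vertex is the
  -- far end of one. Counting starts at 0, which puts the escape clause of `LB` just out of reach.
  walk⇒W : ∀ {a b} → a ≢ b → Walk Sub [] (suc r) (inj₁ a) (inj₁ b) → W a b ⊎ W b a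
  walk⇒W {a} a≢b w with LB-walk a (inj₁ refl) w
  ... | inj₁ b≡a                 = ⊥-elim (a≢b (sym b≡a))
  ... | inj₂ (inj₁ (adj , _))    = adj
  ... | inj₂ (inj₂ r<)           = ⊥-elim (<-irrefl (sym (+-identityʳ (suc r))) r<)

  W⇒walk : ∀ {a b} → a <ᶠ b → W a b → Walk Sub [] (suc r) (inj₁ a) (inj₁ b)
  W⇒walk {a} {b} a<b w = fromBranch r refl
    where
    along : ∀ n (k : Fin r) → suc (toℕ k + n) ≡ r → Walk Sub [] (suc n) (inj₂ (a , b , a<b , k)) (inj₁ b)
    along zero    k e = step (λ ()) (inj₁ ((refl , trans (cong suc (sym (+-identityʳ _))) e) , w)) (stop λ ())
    along (suc n) k e = step (λ ()) (inj₁ ((refl , refl , toℕ-fromℕ< lt) , w))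
      (along n (fromℕ< lt) (trans (cong suc (trans (cong (_+ n) (toℕ-fromℕ< lt)) (sym (+-suc _ n)))) e))
      where
      lt : suc (toℕ k) < r
      lt = subst (suc (toℕ k) <_) e (s≤s (subst (suc (toℕ k) ≤_) (sym (+-suc _ n)) (s≤s (m≤m+n _ n))))
    fromBranch : ∀ n → n ≡ r → Walk Sub [] (suc n) (inj₁ a) (inj₁ b)
    fromBranch zero    e = step (λ ()) (inj₁ ((sym e , a<b) , w)) (stop λ ())
    fromBranch (suc n) e = step (λ ()) (inj₁ ((refl , toℕ-fromℕ< 0<r) , w))
      (along n (fromℕ< 0<r) (trans (cong (λ z → suc (z + n)) (toℕ-fromℕ< 0<r)) e))
      where
      0<r : 0 < r
      0<r = subst (0 <_) e (s≤s z≤n)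

SubdFwd-irrefl : ∀ {m r} (x : SubdVert m r) → ¬ SubdFwd m r x x
SubdFwd-irrefl (inj₁ i)               (_ , i<i)       = <-irrefl refl i<i
SubdFwd-irrefl (inj₂ (_ , _ , _ , k)) (_ , _ , k≡1+k) = 1+n≢n (sym k≡1+k)

pair : ∀ {V : Set} → V → V → Fin 2 → V
pair x y fz     = x
pair x y (fs _) = y

pairTuple-only : ∀ {V : Set} {n} → n ≤ 2 → (t : Vec V n) → ∀ {x y z} → x ∈ᵛ t → y ∈ᵛ t → x ≢ y → z ∈ᵛ t → z ≡ x ⊎ z ≡ y
pairTuple-only n≤2 t {x} {y} {z} x∈ y∈ x≢y z∈ with pairTuple n≤2 (pair x y) {fz} {fs fz} t x∈ y∈ x≢y
... | js , refl , _ , _ = entries js z∈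
  where
  entries : ∀ {n} (js : Vec (Fin 2) n) → z ∈ᵛ mapᵛ (pair x y) js → z ≡ x ⊎ z ≡ y
  entries (fz ∷ js)   (VAny.here p)  = inj₁ p
  entries (fs _ ∷ js) (VAny.here p)  = inj₂ p
  entries (_ ∷ js)    (VAny.there p) = entries js p

module _ {σ : Signature} {m r : ℕ} (M : Structure σ) (emb : InjHom (Ksub m r) (Gaifman M))
         (W : Fin m → Fin m → Set) where
  open Subdivision m r W
  private
    h     = proj₁ emb
    h-inj = proj₁ (proj₂ emb)
    hom   = proj₂ (proj₂ emb)

  -- Pulled back are the tuples of M containing both ends of a kept edge. Having at most two entries
  -- they create no other adjacency, and being tuples of M they keep h a homomorphism, so
  -- monotonicity applies.
  realise : Structure σ
  realise = record
    { Car = SubdVert m r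
    ; rel = λ R t → rel M R (mapᵛ h t) × ∃[ x ] ∃[ y ] (Sub x y × x ∈ᵛ t × y ∈ᵛ t) }

  realise-hom : InjHom realise M
  realise-hom = h , h-inj , λ R t → proj₁

  realise-edge : ∀ x y → GaifEdge realise x y ⇔ Sub x y
  realise-edge x y = mk⇔ to from
    where
    Sub-≢ : ∀ {x y} → Sub x y → x ≢ y
    Sub-≢ {x} (inj₁ (e , _)) refl = SubdFwd-irrefl x e
    Sub-≢ {x} (inj₂ (e , _)) refl = SubdFwd-irrefl x e

    Sub-sym : ∀ {x y} → Sub x y → Sub y x
    Sub-sym (inj₁ e) = inj₂ e
    Sub-sym (inj₂ e) = inj₁ e

    to : GaifEdge realise x y → Sub x y
    to (x≢y , R , t , (_ , a , b , e , a∈ , b∈) , x∈ , y∈)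
      with pairTuple-only (arity≤2 σ R) t x∈ y∈ x≢y a∈ | pairTuple-only (arity≤2 σ R) t x∈ y∈ x≢y b∈
    ... | inj₁ refl | inj₁ refl = ⊥-elim (Sub-≢ e refl)
    ... | inj₁ refl | inj₂ refl = e
    ... | inj₂ refl | inj₁ refl = Sub-sym e
    ... | inj₂ refl | inj₂ refl = ⊥-elim (Sub-≢ e refl)

    from : Sub x y → GaifEdge realise x y
    from e with hom fz (x ∷ y ∷ []) (Sub-edge e)
    ... | hx≢hy , R , t , r , x∈ , y∈ with pairTuple (arity≤2 σ R) (h ∘ (pair x y)) {fz} {fs fz} t x∈ y∈ hx≢hy
    ... | js , refl , i∈ , j∈ = hx≢hy ∘ cong h , R , mapᵛ (pair x y) js ,
          (subst (rel M R) (map-∘ h (pair x y) js) r , x , y , e , ∈ᵛ-map⁺ (pair x y) i∈ , ∈ᵛ-map⁺ (pair x y) j∈) ,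
          ∈ᵛ-map⁺ (pair x y) i∈ , ∈ᵛ-map⁺ (pair x y) j∈

code : ∀ {n} → Subset n → Fin (2 ^ n)
code []            = fz
code (inside ∷ J)  = combine {2} fz (code J)
code (outside ∷ J) = combine {2} (fs fz) (code J)

code-injective : ∀ {n} (I J : Subset n) → code I ≡ code J → I ≡ J
code-injective []            []            _ = refl
code-injective (inside ∷ I)  (inside ∷ J)  e = cong (inside ∷_) (code-injective I J (proj₂ (combine-injective {2} fz (code I) fz (code J) e)))
code-injective (inside ∷ I)  (outside ∷ J) e with proj₁ (combine-injective {2} fz (code I) (fs fz) (code J) e)
... | ()
code-injective (outside ∷ I) (inside ∷ J)  e with proj₁ (combine-injective {2} (fs fz) (code I) fz (code J) e)
... | ()
code-injective (outside ∷ I) (outside ∷ J) e = cong (outside ∷_) (code-injective I J (proj₂ (combine-injective {2} (fs fz) (code I) (fs fz) (code J) e)))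

-- Every graph being realised up to r-subdivision, "there is a walk of length r + 1" codes arbitrary bipartite graphs.
subdivisions⇒independence : ∀ {σ} (C : Class σ) r →
  (∀ m (W : Fin m → Fin m → Set) → Σ[ rel' ∈ ((R : Fin (nsym σ)) → Vec (SubdVert m r) (arity σ R) → Set) ]
    (C (record { Car = SubdVert m r ; rel = rel' }) ×
     (∀ x y → GaifEdge {σ} (record { Car = SubdVert m r ; rel = rel' }) x y ⇔ Subdivision.Sub m r W x y))) →
  IndependenceProperty C 1 1 (walk (suc r) fz (fs fz))
subdivisions⇒independence {σ} C r realised n = M , M∈C , (λ i _ → inj₁ (α i)) , (λ J _ → inj₁ (β J)) , correct
  where
  α : Fin n → Fin (n + 2 ^ n)
  α i = i ↑ˡ 2 ^ n
  β : Subset n → Fin (n + 2 ^ n)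
  β J = n ↑ʳ code J
  -- The incidence graph of points and subsets; every point is numbered below every subset, the
  -- orientation that `W⇒walk` expects.
  W : Fin (n + 2 ^ n) → Fin (n + 2 ^ n) → Set
  W a b = ∃[ i ] ∃[ J ] (a ≡ α i × b ≡ β J × i ∈ˢ J)
  open Subdivision (n + 2 ^ n) r W
  M : Structure σ
  M = record { Car = SubdVert (n + 2 ^ n) r ; rel = proj₁ (realised (n + 2 ^ n) W) }
  M∈C : C M
  M∈C = proj₁ (proj₂ (realised (n + 2 ^ n) W))
  edges : ∀ x y → GaifEdge M x y ⇔ Sub x y
  edges = proj₂ (proj₂ (realised (n + 2 ^ n) W))

  α<β : ∀ i J → α i <ᶠ β J
  α<β i J = subst₂ _<_ (sym (toℕ-↑ˡ i (2 ^ n))) (sym (toℕ-↑ʳ n (code J))) (<-≤-trans (toℕ<n i) (m≤m+n n _))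

  mapWalk : ∀ {V : Set} {E E' : V → V → Set} → (∀ {x y} → E x y → E' x y) → ∀ {n x y} → Walk E [] n x y → Walk E' [] n x y
  mapWalk f (stop p)     = stop p
  mapWalk f (step p e w) = step p (f e) (mapWalk f w)

  W⁻ : ∀ i J → W (α i) (β J) ⊎ W (β J) (α i) → i ∈ˢ J
  W⁻ i J (inj₁ (i' , J' , p , q , i∈)) =
    subst₂ _∈ˢ_ (sym (↑ˡ-injective (2 ^ n) i i' p)) (sym (code-injective J J' (↑ʳ-injective n _ _ q))) i∈
  W⁻ i J (inj₂ (i' , J' , p , _)) = ⊥-elim (<ᶠ⇒≢ (α<β i' J) (sym p))

  correct : ∀ i J → Sat M (walk (suc r) fz (fs fz)) ((λ (_ : Fin 1) → inj₁ (α i)) VF.++ (λ (_ : Fin 1) → inj₁ (β J))) ⇔ (i ∈ˢ J)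
  correct i J = mk⇔
    (λ s → W⁻ i J (walk⇒W (<ᶠ⇒≢ (α<β i J)) (mapWalk (Equivalence.to (edges _ _)) (Equivalence.to (Sat-walk (suc r)) s))))
    (λ i∈ → Equivalence.from (Sat-walk (suc r)) (mapWalk (Equivalence.from (edges _ _)) (W⇒walk (α<β i J) (i , J , refl , refl , i∈))))

-- The implications between the six conditions

stable⇒dependent : ∀ {σ} {C : Class σ} → Stable C → Dependent C
stable⇒dependent {C = C} stable p q φ ip = stable p q φ order
  where
  order : OrderProperty C p q φ
  order n with ip n
  ... | M , M∈C , a , b , h = M , M∈C , a , b ∘ below , λ i j → mk⇔
          (λ s → ∈-below⁻ (Equivalence.to (h i (below j)) s)) (λ i<j → Equivalence.from (h i (below j)) (∈-below⁺ i<j))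
    where
    -- Initial segments among the index sets turn membership into the order.
    below : Fin n → Subset n
    below j = tabulate (λ i → does (i <ᶠ? j))
    ∈-below⁺ : ∀ {i j} → i <ᶠ j → i ∈ˢ below j
    ∈-below⁺ {i} {j} i<j = lookup⇒[]= i (below j) (trans (lookup∘tabulate _ i) (dec-true (i <ᶠ? j) i<j))
    ∈-below⁻ : ∀ {i j} → i ∈ˢ below j → i <ᶠ j
    ∈-below⁻ {i} {j} i∈ with i <ᶠ? j in eq
    ... | yes i<j = i<j
    ... | no _ with trans (sym (cong does eq)) (trans (sym (lookup∘tabulate (λ i → does (i <ᶠ? j)) i)) ([]=⇒lookup i∈))
    ... | ()

Gaifman∈Underlying : ∀ {σ} {C : Class σ} {M} → C M → Underlying C (Gaifman M)
Gaifman∈Underlying {M = M} M∈C = M , M∈C , id , id , (λ y → y , refl) , λ { fz (a ∷ b ∷ []) → mk⇔ id id }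

-- The ladder bound speaks of Gaifman graphs; for a class of graphs it has to be read in terms of
-- the edge relation itself.
Edge-of-Gaifman : ∀ {G : Structure graphSig} → (∀ {x y} → Edge G x y → Edge G y x) → ∀ {x y} → GaifEdge G x y → Edge G x y
Edge-of-Gaifman G-sym (ne , fz , a ∷ b ∷ [] , e , VAny.here refl , VAny.here refl) = ⊥-elim (ne refl)
Edge-of-Gaifman G-sym (ne , fz , a ∷ b ∷ [] , e , VAny.here refl , VAny.there (VAny.here refl)) = e
Edge-of-Gaifman G-sym (ne , fz , a ∷ b ∷ [] , e , VAny.there (VAny.here refl) , VAny.here refl) = G-sym e
Edge-of-Gaifman G-sym (ne , fz , a ∷ b ∷ [] , e , VAny.there (VAny.here refl) , VAny.there (VAny.here refl)) = ⊥-elim (ne refl)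

Underlying-sym : ∀ {σ} {C : Class σ} {G} → Underlying C G → ∀ {x y} → Edge G x y → Edge G y x
Underlying-sym (M , _ , g , _ , _ , iso) {x} {y} e =
  Equivalence.from (iso fz (y ∷ x ∷ [])) (GaifEdge-sym M (Equivalence.to (iso fz (x ∷ y ∷ [])) e))

module _ (em : ExcludedMiddle 0ℓ) {σ : Signature} {C : Class σ} (superflat : Superflat (Underlying C)) where
  open SparsePaths em
  open Bounds em

  private
    f : ℕ → ℕ
    f r = proj₁ (superflat r)

  sparse-Edge : ∀ {G} → Underlying C G → Sparse f (Edge G)
  sparse-Edge {G} G∈ = Underlying-sym {C = C} {G} G∈ , λ { r (h , h-inj , fwd) → proj₂ (superflat r) G G∈
    (h , h-inj , λ { fz (a ∷ b ∷ []) (inj₁ e) → fwd a b e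
                   ; fz (a ∷ b ∷ []) (inj₂ e) → Underlying-sym {C = C} {G} G∈ (fwd b a e) }) }

  sparse-GaifEdge : ∀ {M} → C M → Sparse f (GaifEdge M)
  sparse-GaifEdge M∈C = sparse-Edge (Gaifman∈Underlying {C = C} M∈C)

  sparse-GaifEdge-Edge : ∀ {G} → Underlying C G → Sparse f (GaifEdge G)
  sparse-GaifEdge-Edge {G} G∈ = GaifEdge-sym G ,
    λ { r (h , h-inj , fwd) → proj₂ (sparse-Edge G∈) r
          (h , h-inj , λ x y e → Edge-of-Gaifman {G} (Underlying-sym {C = C} {G} G∈) (fwd x y e)) }

  sparse⇒stable : ∀ {τ} {D : Class τ} → (∀ {M} → D M → Sparse f (GaifEdge M)) → Stable D
  sparse⇒stable sparse p q φ op with ladderBound f p q φ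
  ... | n , bounded with op n
  ... | M , M∈D , a , b , order = bounded M (sparse M∈D) a b order

  superflat⇒stable : Stable C
  superflat⇒stable = sparse⇒stable sparse-GaifEdge

  superflat⇒stable-Underlying : Stable (Underlying C)
  superflat⇒stable-Underlying = sparse⇒stable sparse-GaifEdge-Edge

  superflat⇒nowhereDense : NowhereDense (Underlying C)
  superflat⇒nowhereDense r with minorBound f r
  ... | N , bounded = N , λ m G G∈ → bounded m G (sparse-Edge G∈)

module _ (em : ∀ {ℓ : Level} → ExcludedMiddle ℓ) {σ : Signature} {C : Class σ} (mono : Monotone C) where

  notSuperflat : ∀ r → ¬ (∃[ m ] (∀ G → Underlying C G → ¬ InjHom (Ksub m r) G)) →
    ∀ m → Σ[ M ∈ Structure σ ] (C M × InjHom (Ksub m r) (Gaifman M))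
  notSuperflat r none m with em {P = Σ[ M ∈ Structure σ ] (C M × InjHom (Ksub m r) (Gaifman M))}
  ... | yes found = found
  ... | no ¬found = ⊥-elim (none (m , λ { G (M , M∈C , g , g-inj , _ , iso) (h , h-inj , hom) →
          ¬found (M , M∈C , g ∘ h , h-inj ∘ g-inj ,
            λ { fz (a ∷ b ∷ []) e → Equivalence.to (iso fz (h a ∷ h b ∷ [])) (hom fz (a ∷ b ∷ []) e) }) }))

  dependent⇒superflat : Dependent C → Superflat (Underlying C)
  dependent⇒superflat dep r with em {P = ∃[ m ] (∀ G → Underlying C G → ¬ InjHom (Ksub m r) G)}
  ... | yes bounded = bounded
  ... | no none = ⊥-elim (dep 1 1 (walk (suc r) fz (fs fz)) (subdivisions⇒independence C r λ m W →
          let M , M∈C , h = notSuperflat r none m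
          in rel (realise M h W) , mono (realise M h W) M (realise-hom M h W) M∈C , realise-edge M h W))

  -- The subdivided graphs needed are Gaifman graphs of the structures `realise M h W`, which
  -- monotonicity places in C.
  dependent-Underlying⇒superflat : Dependent (Underlying C) → Superflat (Underlying C)
  dependent-Underlying⇒superflat dep r with em {P = ∃[ m ] (∀ G → Underlying C G → ¬ InjHom (Ksub m r) G)}
  ... | yes bounded = bounded
  ... | no none = ⊥-elim (dep 1 1 (walk (suc r) fz (fs fz)) (subdivisions⇒independence (Underlying C) r realised))
    where
    realised : ∀ m (W : Fin m → Fin m → Set) → Σ[ rel' ∈ ((R : Fin 1) → Vec (SubdVert m r) 2 → Set) ]
      (Underlying C (record { Car = SubdVert m r ; rel = rel' }) ×
       (∀ x y → GaifEdge {graphSig} (record { Car = SubdVert m r ; rel = rel' }) x y ⇔ Subdivision.Sub m r W x y))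
    realised m W with notSuperflat r none m
    ... | M , M∈C , h = rel (Gaifman N) , Gaifman∈Underlying {C = C} (mono N M (realise-hom M h W) M∈C) , λ x y → mk⇔
            (Equivalence.to (realise-edge M h W x y) ∘ Edge-of-Gaifman {Gaifman N} (GaifEdge-sym N))
            (λ s → let e = Equivalence.from (realise-edge M h W x y) s in
                   proj₁ e , fz , (x ∷ y ∷ []) , e , VAny.here refl , VAny.there (VAny.here refl))
      where N = realise M h W

nowhereDense⇒superflat : ∀ {𝒢 : Class graphSig} → NowhereDense 𝒢 → Superflat 𝒢
nowhereDense⇒superflat nd r with nd r
... | N , bounded = suc N , λ G G∈ emb → <-irrefl refl (bounded (suc N) G G∈ (subdivision-minor G emb))
  where
  subdivision-minor : ∀ {m} G → InjHom (Ksub m r) G → IsMinor r (K m) G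
  subdivision-minor {m} G emb = Ksub m r , (Ksub-sym , Ksub-irrefl) , emb , π ,
    (λ x → inj₁ x , refl) , (λ x → inj₁ x , refl , reach x) ,
    λ x y → mk⇔ (λ x≢y → x≢y , joined x y x≢y) proj₁
    where
    Ksub-sym : ∀ a b → Edge (Ksub m r) a b → Edge (Ksub m r) b a
    Ksub-sym a b (inj₁ e) = inj₂ e
    Ksub-sym a b (inj₂ e) = inj₁ e
    Ksub-irrefl : ∀ a → ¬ Edge (Ksub m r) a a
    Ksub-irrefl a (inj₁ e) = SubdFwd-irrefl a e
    Ksub-irrefl a (inj₂ e) = SubdFwd-irrefl a e

    -- A branch vertex absorbs the inner vertices of its paths to larger branch vertices, all within
    -- distance r; the final edge of each path joins two classes.
    π : SubdVert m r → Fin m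
    π (inj₁ i)       = i
    π (inj₂ (i , _)) = i

    In : Fin m → ℕ → SubdVert m r → SubdVert m r → Set
    In x = WalkIn (Ksub m r) (λ w → π w ≡ x)

    stay : ∀ {x} n v → In x n v v
    stay zero    v = refl
    stay (suc n) v = inj₁ refl

    longer : ∀ {x n n' v w} → n ≤ n' → In x n v w → In x n' v w
    longer {n' = n'} z≤n refl = stay n' _
    longer (s≤s l) (inj₁ e)               = inj₁ e
    longer (s≤s l) (inj₂ (z , e , p , w)) = inj₂ (z , e , p , longer l w)

    along : ∀ {i j} (i<j : i <ᶠ j) n (k k' : Fin r) → toℕ k + n ≡ toℕ k' →
      In i n (inj₂ (i , j , i<j , k)) (inj₂ (i , j , i<j , k'))
    along i<j zero    k k' e = cong (λ k → inj₂ (_ , _ , i<j , k)) (toℕ-injective (trans (sym (+-identityʳ _)) e))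
    along i<j (suc n) k k' e = inj₂ (_ , inj₁ (refl , refl , toℕ-fromℕ< lt) , refl ,
      along i<j n (fromℕ< lt) k' (trans (cong (_+ n) (toℕ-fromℕ< lt)) (trans (sym (+-suc (toℕ k) n)) e)))
      where
      lt : suc (toℕ k) < r
      lt = ≤-<-trans (subst (suc (toℕ k) ≤_) (trans (sym (+-suc (toℕ k) n)) e) (s≤s (m≤m+n _ n))) (toℕ<n k')

    reach : ∀ x v → π v ≡ x → In x r (inj₁ x) v
    reach x (inj₁ .x) refl = stay r _
    reach x (inj₂ (.x , j , x<j , k)) refl = longer (toℕ<n k)
      (inj₂ (_ , inj₁ (refl , toℕ-fromℕ< 0<r) , refl , along x<j (toℕ k) (fromℕ< 0<r) k (cong (_+ toℕ k) (toℕ-fromℕ< 0<r))))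
      where
      0<r : 0 < r
      0<r = ≤-<-trans z≤n (toℕ<n k)

    last : ∀ {x y} → x <ᶠ y → ∃[ u ] (π u ≡ x × SubdFwd m r u (inj₁ y))
    last {x} {y} x<y = go r refl
      where
      -- When r = 0 there is no inner vertex, and x itself is adjacent to y.
      go : ∀ n → n ≡ r → ∃[ u ] (π u ≡ x × SubdFwd m r u (inj₁ y))
      go zero    e = inj₁ x , refl , sym e , x<y
      go (suc n) e = inj₂ (x , y , x<y , fromℕ< (≤-reflexive e)) , refl , refl , trans (cong suc (toℕ-fromℕ< (≤-reflexive e))) e

    joined : ∀ x y → x ≢ y → ∃[ u ] ∃[ v ] (π u ≡ x × π v ≡ y × Edge (Ksub m r) u v)
    joined x y x≢y with <ᶠ-cmp x y
    ... | tri< x<y _ _ = let u , p , e = last x<y in u , inj₁ y , p , refl , inj₁ e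
    ... | tri≈ _ x≡y _ = ⊥-elim (x≢y x≡y)
    ... | tri> _ _ y<x = let v , p , e = last y<x in inj₁ x , v , refl , p , inj₂ e

theorem5p2 : (em : ∀ {ℓ : Level} → ExcludedMiddle ℓ) →
    ∀ {σ : Signature} (C : Class σ) → Monotone C →
    (NowhereDense (Underlying C) ⇔ Superflat (Underlying C)) ×
    (NowhereDense (Underlying C) ⇔ Stable C) ×
    (NowhereDense (Underlying C) ⇔ Stable (Underlying C)) ×
    (NowhereDense (Underlying C) ⇔ Dependent C) ×
    (NowhereDense (Underlying C) ⇔ Dependent (Underlying C))
theorem5p2 em C mono =
  mk⇔ flat nowhereDense ,
  mk⇔ (superflat⇒stable em ∘ flat)
      (nowhereDense ∘ dependent⇒superflat em mono ∘ stable⇒dependent) ,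
  mk⇔ (superflat⇒stable-Underlying em ∘ flat)
      (nowhereDense ∘ dependent-Underlying⇒superflat em mono ∘ stable⇒dependent) ,
  mk⇔ (stable⇒dependent ∘ superflat⇒stable em ∘ flat)
      (nowhereDense ∘ dependent⇒superflat em mono) ,
  mk⇔ (stable⇒dependent ∘ superflat⇒stable-Underlying em ∘ flat)
      (nowhereDense ∘ dependent-Underlying⇒superflat em mono)
  where
  flat : NowhereDense (Underlying C) → Superflat (Underlying C)
  flat = nowhereDense⇒superflat
  nowhereDense : Superflat (Underlying C) → NowhereDense (Underlying C)
  nowhereDense = superflat⇒nowhereDense em
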